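{- Let $A$ be a Henselian valuation ring, not a field, with field of fractions $K$, let $\bar K$ be a separable closure of $K$ and $\bar A$ the integral closure of $A$ in $\bar K$. For nonzero proper ideals $I$, $J$ of $\bar A$ we have $\mathrm{Gal}(\bar K/K)^I_{\log}\subset \mathrm{Gal}(\bar K/K)^I_{\mathrm{nlog}}$, and if $I\supset J$ then $\mathrm{Gal}(\bar K/K)^I_{\log}\supset \mathrm{Gal}(\bar K/K)^J_{\log}$ and $\mathrm{Gal}(\bar K/K)^I_{\mathrm{nlog}}\supset \mathrm{Gal}(\bar K/K)^J_{\mathrm{nlog}}$.
   Context: **Upper ramification groups.** For a finite set $S$, let $R=\bar K[\{y_s\}_{s\in S}]$ and $R^+=\bar A[\{y_s\}_{s\in S}]$ ($y_s$ indeterminates). Let $D^S$ be the set of pairs $z=(\mathfrak p,V)$ where $\mathfrak p$ is a prime ideal of $R$ and $V$ is a valuation ring contained in the residue field $\kappa(\mathfrak p)$, containing the image of $R^+$, with $\bar K\otimes_{\bar A}V=\kappa(\mathfrak p)$, and such that the preimage in $\bar A$ of the maximal ideal of $V$ is the maximal ideal of $\bar A$. For $f\in R$ let $|f|(z)$ be the image of $f$ in $\kappa(\mathfrak p)/V^\times$, totally ordered by: $a\le b$ iff $V\tilde a\subset V\tilde b$ for representatives $\tilde a,\tilde b$. $D^S$ has the weakest topology for which all sets $\{z : |f|(z)\le |g|(z)\ne 0\}$ ($f,g\in R$) are open. Let $L\subset\bar K$ be a finite Galois extension of $K$ and $B$ the integral closure of $A$ in $L$. A pre-presentation for $L/K$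 is a pair $(S,T)$ with $S$ a finite subset of $B$ and $T$ a finite subset of the kernel of $A[\{y_s\}_{s\in S}]\to B$, $y_s\mapsto s$. For a nonzero proper ideal $I$ of $\bar A$, $X(S,T,I)$ is the open subspace of $D^S$ of all $z$ such that for each $t\in T$ there is $a\in I$ with $|t|(z)\le |a|(z)$. Let $\Phi(L/K)$ be the set of $K$-homomorphisms $L\to\bar K$; $\phi\in\Phi(L/K)$ is regarded as the point $(\mathfrak p,V)$ of $X(S,T,I)$ with $\mathfrak p=\ker(R\to\bar K, y_s\mapsto\phi(s))$ and $V=\bar A\subset\bar K=\kappa(\mathfrak p)$. $(S,T,I)$ separates $L/K$ if $X(S,T,I)=\coprod_{\phi\in\Phi(L/K)}U_\phi$ for some open and closed subsets $U_\phi$ with $\phi\in U_\phi$. The ramification of $L/K$ is non-logarithmically bounded by $I$ if some pre-presentation $(S,T)$ is such that $(S,T,I)$ separates $L/K$. It is logarithmically bounded by $I$ if there is a log smooth extension $A'/A$ of Henselian valuation rings, with field of fractions $K'$, such that the ramification of $LK'/K'$ is non-logarithmically bounded by $\bar A'I$, where $\bar A'$ is the integral closure of $A'$ in a separable closure $\bar K'$ of $K'$ containing $\bar K$. $\mathrm{Gal}(\bar K/K)^I_{\log}$ (resp. $\mathrm{Gal}(\bar K/K)^I_{\mathrm{nlog}}$) is the intersection of the kernels of $\mathrm{Gal}(\bar K/K)\to\mathrm{Gal}(L/K)$ over all finite Galois $L/K$ in $\bar K$ with ramification logarithmically (resp. non-logarithmically) bounded by $I$. **Log smooth extensions.** Let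 $A'\supset A$ be a Henselian valuation ring dominating $A$, with field of fractions $K'$. (1) A valuative monoid for an abelian group $\Lambda$ is a submonoid $\mathscr V$ with $x\in\mathscr V$ or $x^{ -1}\in\mathscr V$ for each $x\in\Lambda$; a submonoid $\mathscr M_2$ dominates $\mathscr M_1$ if $\mathscr M_1\subset\mathscr M_2$ and $\mathscr M_2^\times\cap\mathscr M_1=\mathscr M_1^\times$. Given an abelian group $\Lambda\supset K^\times$ with $\Lambda/K^\times$ free of finite rank and a valuative monoid $\mathscr V$ for $\Lambda$ dominating $\mathscr V_0=A\smallsetminus\{0\}$, put $R=A\otimes_{\mathbb Z[\mathscr V_0]}\mathbb Z[\mathscr V]$ and let $\mathfrak p$ be the ideal generated by the image of $\mathscr V\smallsetminus\mathscr V^\times$; then $\mathfrak p$ is prime and $R_{\mathfrak p}$ is a valuation ring. $A'/A$ is log smooth of rational type if $A'$ is $A$-isomorphic to the Henselization of such an $R_{\mathfrak p}$. (2) $A'/A$ is a tame finite extension if $K'/K$ is finite, $[K':K]=e(K'/K)f(K'/K)$, $e(K'/K)$ is invertible in $A$, and the residue field extension is separable. (3) $A'/A$ is log smooth if there is a chain $A=A_0\subset\dots\subset A_n=A'$ of Henselian valuation rings with each $A_i/A_{i-1}$ either log smooth of rational type or tame finite. -}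

module Defs where

open import Level using (Level; suc)
open import Algebra.Bundles using (CommutativeRing; AbelianGroup; CommutativeMonoid; RawRing)
open import Algebra.Structures using (IsCommutativeRing; IsAbelianGroup; IsCommutativeMonoid)
open import Algebra.Morphism.Bundles using (RingHomomorphism; GroupHomomorphism)
open import Algebra.Morphism.Structures
open import Algebra.Definitions.RawMagma using () renaming (_,_ to infixr 4 _⸴_)
import Algebra.Definitions.RawMonoid
import Algebra.Definitions.RawSemiring
open import Data.Fin.Base using (Fin; toℕ)
open import Data.Integer.Base as ℤ using (ℤ; +_; -[1+_])
open import Data.List.Base using (List; []; _∷_)
open import Data.List.Relation.Unary.All using (All)
open import Data.Nat.Base as ℕ using (ℕ)
open import Data.Product.Base using (Σ; Σ-syntax; ∃; ∃-syntax; _×_; _,_; proj₁; proj₂)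
open import Data.Sum.Base using (_⊎_; inj₁; inj₂; [_,_]′)
open import Data.Unit.Base using (⊤; tt)
open import Function.Base using (id; const)
open import Function.Bundles using (Bijection; _⇔_)
open import Function.Definitions using (Injective; Bijective)
open import Relation.Binary.Core using (Rel)
open import Relation.Binary.PropositionalEquality.Core as ≡ using (_≡_)
import Relation.Binary.PropositionalEquality.Properties as ≡
open import Relation.Nullary.Negation.Core using (¬_)
open import Relation.Unary using (Pred; _∈_; _∉_; _⊆_; _≐_; _∩_; _∖_)

private variable
  ℓ : Level

CRing : ∀ ℓ → Set (suc ℓ)
CRing ℓ = CommutativeRing ℓ ℓ

Elt : CRing ℓ → Set ℓ
Elt = CommutativeRing.Carrier

infix 4 _⟶_
record _⟶_ (R S : CRing ℓ) : Set ℓ where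
  constructor hom
  field
    ringHomomorphism : RingHomomorphism (CommutativeRing.rawRing R) (CommutativeRing.rawRing S)
  open RingHomomorphism ringHomomorphism public renaming (⟦_⟧ to infixl 20 _⟨$⟩_)

open _⟶_ public using (_⟨$⟩_)

-- Preservation of 0 and of negation follows from the remaining laws.
module _ {R S : CRing ℓ} where
  private
    module R = CommutativeRing R
    module S = CommutativeRing S
  open import Algebra.Properties.Ring S.ring using (x+x≈x⇒x≈0; +-inverseˡ-unique)

  module _ (f : Elt R → Elt S)
           (f-cong : ∀ {x y} → x R.≈ y → f x S.≈ f y)
           (f-+ : ∀ x y → f (x R.+ y) S.≈ f x S.+ f y)
           (f-* : ∀ x y → f (x R.* y) S.≈ f x S.* f y)
           (f-1 : f R.1# S.≈ S.1#) where
    abstract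
      mkHom-laws : RingMorphisms.IsRingHomomorphism R.rawRing S.rawRing f
      mkHom-laws = record
        { isSemiringHomomorphism = record
          { isNearSemiringHomomorphism = record
            { +-isMonoidHomomorphism = record
              { isMagmaHomomorphism = record
                { isRelHomomorphism = record { cong = f-cong }
                ; homo = f-+ }
              ; ε-homo = f-0 }
            ; *-homo = f-* }
          ; 1#-homo = f-1 }
        ; -‿homo = λ x → +-inverseˡ-unique (f (R.- x)) (f x)
            (S.trans (S.sym (f-+ (R.- x) x)) (S.trans (f-cong (R.-‿inverseˡ x)) f-0)) }
        where
        f-0 : f R.0# S.≈ S.0#
        f-0 = x+x≈x⇒x≈0 (f R.0#)
          (S.trans (S.sym (f-+ R.0# R.0#)) (f-cong (R.+-identityˡ R.0#)))

    mkHom : R ⟶ S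
    mkHom = hom (record { ⟦_⟧ = f ; isRingHomomorphism = mkHom-laws })

idHom : {R : CRing ℓ} → R ⟶ R
idHom {R = R} = mkHom id id (λ _ _ → refl) (λ _ _ → refl) refl
  where open CommutativeRing R

infixr 9 _⊙_
_⊙_ : {R S T : CRing ℓ} → S ⟶ T → R ⟶ S → R ⟶ T
_⊙_ {R = R} {S} {T} g f = mkHom (λ x → g ⟨$⟩ (f ⟨$⟩ x))
  (λ p → g.⟦⟧-cong (f.⟦⟧-cong p))
  (λ x y → T.trans (g.⟦⟧-cong (f.+-homo x y)) (g.+-homo _ _))
  (λ x y → T.trans (g.⟦⟧-cong (f.*-homo x y)) (g.*-homo _ _))
  (T.trans (g.⟦⟧-cong f.1#-homo) g.1#-homo)
  where
  module T = CommutativeRing T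
  module f = _⟶_ f
  module g = _⟶_ g

module Arithmetic {ℓ} (R : CRing ℓ) =
  Algebra.Definitions.RawSemiring (RawRing.rawSemiring (CommutativeRing.rawRing R))

module _ (R : CRing ℓ) where
  open CommutativeRing R
  open Arithmetic R using (_∣_)

  IsUnit : Pred (Elt R) ℓ
  IsUnit x = x ∣ 1#

  record IsDomain : Set ℓ where
    field
      1≉0              : ¬ 1# ≈ 0#
      no-zero-divisors : ∀ {x y} → x * y ≈ 0# → x ≈ 0# ⊎ y ≈ 0#

  -- Zero is detachable, so that a field is constructively a domain.
  record IsField : Set ℓ where
    field
      1≉0       : ¬ 1# ≈ 0#
      0-or-unit : ∀ x → x ≈ 0# ⊎ IsUnit x

  record IsValuationRing : Set ℓ where
    field
      isDomain : IsDomain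
      ∣-total  : ∀ x y → x ∣ y ⊎ y ∣ x

  -- The non-units form an ideal; closure under multiples is automatic.
  record IsLocal : Set ℓ where
    field
      0-nonunit : ¬ IsUnit 0#
      +-nonunit : ∀ {x y} → ¬ IsUnit x → ¬ IsUnit y → ¬ IsUnit (x + y)

  record Ideal : Set (suc ℓ) where
    field
      member   : Pred (Elt R) ℓ
      resp     : ∀ {x y} → x ≈ y → x ∈ member → y ∈ member
      0-closed : 0# ∈ member
      +-closed : ∀ {x y} → x ∈ member → y ∈ member → x + y ∈ member
      *-closed : ∀ x {y} → y ∈ member → x * y ∈ member

  open Ideal using (member)

  record IsPrime (I : Ideal) : Set ℓ where
    field
      proper : 1# ∉ member I
      split  : ∀ {x y} → x * y ∈ member I → x ∈ member I ⊎ y ∈ member I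

  data Generated (P : Pred (Elt R) ℓ) : Pred (Elt R) ℓ where
    incl    : ∀ {x} → x ∈ P → x ∈ Generated P
    by-resp : ∀ {x y} → x ≈ y → x ∈ Generated P → y ∈ Generated P
    by-0    : 0# ∈ Generated P
    by-+    : ∀ {x y} → x ∈ Generated P → y ∈ Generated P → x + y ∈ Generated P
    by-*    : ∀ x {y} → y ∈ Generated P → x * y ∈ Generated P

  generated : Pred (Elt R) ℓ → Ideal
  generated P = record
    { member = Generated P ; resp = by-resp ; 0-closed = by-0 ; +-closed = by-+ ; *-closed = by-* }

  record IsMultiplicative (M : Pred (Elt R) ℓ) : Set ℓ where
    field
      1-closed : 1# ∈ M
      *-closed : ∀ {x y} → x ∈ M → y ∈ M → x * y ∈ M

  record IsSubring (P : Pred (Elt R) ℓ) : Set ℓ where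
    field
      resp     : ∀ {x y} → x ≈ y → x ∈ P → y ∈ P
      +-closed : ∀ {x y} → x ∈ P → y ∈ P → x + y ∈ P
      *-closed : ∀ {x y} → x ∈ P → y ∈ P → x * y ∈ P
      -‿closed : ∀ {x} → x ∈ P → - x ∈ P
      0-closed : 0# ∈ P
      1-closed : 1# ∈ P

  abstract
    field⇒domain : IsField → IsDomain
    field⇒domain F = record { 1≉0 = 1≉0 ; no-zero-divisors = λ {x} {y} → split x y }
      where
      open IsField F
      open import Relation.Binary.Reasoning.Setoid setoid
      split : ∀ x y → x * y ≈ 0# → x ≈ 0# ⊎ y ≈ 0#
      split x y xy≈0 with 0-or-unit x
      ... | inj₁ x≈0 = inj₁ x≈0
      ... | inj₂ (x⁻¹ ⸴ eq) = inj₂ (begin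
        y              ≈⟨ *-identityˡ y ⟨
        1# * y         ≈⟨ *-congʳ eq ⟨
        x⁻¹ * x * y    ≈⟨ *-assoc x⁻¹ x y ⟩
        x⁻¹ * (x * y)  ≈⟨ *-congˡ xy≈0 ⟩
        x⁻¹ * 0#       ≈⟨ zeroʳ x⁻¹ ⟩
        0#             ∎)

open Ideal public using (member)

module _ {R : CRing ℓ} {P : Pred (Elt R) ℓ} (P-subring : IsSubring R P) where
  open CommutativeRing R
  open IsSubring P-subring

  abstract
    subring-laws : IsCommutativeRing {A = ∃ P} (λ x y → proj₁ x ≈ proj₁ y)
      (λ x y → proj₁ x + proj₁ y , +-closed (proj₂ x) (proj₂ y))
      (λ x y → proj₁ x * proj₁ y , *-closed (proj₂ x) (proj₂ y))
      (λ x → - proj₁ x , -‿closed (proj₂ x)) (0# , 0-closed) (1# , 1-closed)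
    subring-laws = record
      { isRing = record
        { +-isAbelianGroup = record
          { isGroup = record
            { isMonoid = record
              { isSemigroup = record
                { isMagma = record
                  { isEquivalence = record { refl = refl ; sym = sym ; trans = trans }
                  ; ∙-cong = +-cong }
                ; assoc = λ _ _ _ → +-assoc _ _ _ }
              ; identity = (λ _ → +-identityˡ _) , (λ _ → +-identityʳ _) }
            ; inverse = (λ _ → -‿inverseˡ _) , (λ _ → -‿inverseʳ _)
            ; ⁻¹-cong = -‿cong }
          ; comm = λ _ _ → +-comm _ _ }
        ; *-cong = *-cong
        ; *-assoc = λ _ _ _ → *-assoc _ _ _
        ; *-identity = (λ _ → *-identityˡ _) , (λ _ → *-identityʳ _)
        ; distrib = (λ _ _ _ → distribˡ _ _ _) , (λ _ _ _ → distribʳ _ _ _) }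
      ; *-comm = λ _ _ → *-comm _ _ }

  subring : CRing ℓ
  subring = record
    { Carrier = ∃ P
    ; _≈_ = λ x y → proj₁ x ≈ proj₁ y
    ; _+_ = λ x y → proj₁ x + proj₁ y , +-closed (proj₂ x) (proj₂ y)
    ; _*_ = λ x y → proj₁ x * proj₁ y , *-closed (proj₂ x) (proj₂ y)
    ; -_  = λ x → - proj₁ x , -‿closed (proj₂ x)
    ; 0#  = 0# , 0-closed
    ; 1#  = 1# , 1-closed
    ; isCommutativeRing = subring-laws }

  inclusion : subring ⟶ R
  inclusion = mkHom proj₁ id (λ _ _ → refl) (λ _ _ → refl) refl

module _ {R : CRing ℓ} (I : Ideal R) where
  open CommutativeRing R
  open Ideal I
  private
    infix 4 _∼_
    _∼_ : Rel (Elt R) ℓ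
    x ∼ y = x + - y ∈ member I

    open import Algebra.Properties.Ring ring using (-1*x≈-x; -‿+-comm; -0#≈0#)
    open import Algebra.Solver.Ring.NaturalCoefficients.Default commutativeSemiring
      using (solve; _:=_; _:+_; _:*_)
    open import Relation.Binary.Reasoning.Setoid setoid

    of-≈ : ∀ {x y} → x ≈ y → x ∼ y
    of-≈ {x} {y} p = resp (sym (trans (+-congʳ p) (-‿inverseʳ y))) 0-closed

    from : ∀ {i x y} → i ∈ member I → x ≈ i + y → x ∼ y
    from {i} {x} {y} i∈I p = resp (begin
      i              ≈⟨ +-identityʳ i ⟨
      i + 0#         ≈⟨ +-congˡ (-‿inverseʳ y) ⟨
      i + (y + - y)  ≈⟨ +-assoc i y (- y) ⟨
      i + y + - y    ≈⟨ +-congʳ p ⟨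
      x + - y        ∎) i∈I

    to : ∀ x y → x ≈ (x + - y) + y
    to x y = begin
      x              ≈⟨ +-identityʳ x ⟨
      x + 0#         ≈⟨ +-congˡ (-‿inverseˡ y) ⟨
      x + (- y + y)  ≈⟨ +-assoc x (- y) y ⟨
      x + - y + y    ∎

    -‿closed : ∀ {x} → x ∈ member I → - x ∈ member I
    -‿closed p = resp (-1*x≈-x _) (*-closed (- 1#) p)

    ∼-sym : ∀ {x y} → x ∼ y → y ∼ x
    ∼-sym {x} {y} p = from (-‿closed p) (begin
      y                                  ≈⟨ +-identityˡ y ⟨
      0# + y                             ≈⟨ +-congʳ (-‿inverseˡ (x + - y)) ⟨
      - (x + - y) + (x + - y) + y        ≈⟨ +-assoc _ _ y ⟩
      - (x + - y) + (x + - y + y)        ≈⟨ +-congˡ (to x y) ⟨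
      - (x + - y) + x                    ∎)

    ∼-trans : ∀ {x y z} → x ∼ y → y ∼ z → x ∼ z
    ∼-trans {x} {y} {z} p q = from (+-closed p q)
      (trans (to x y) (trans (+-congˡ (to y z)) (sym (+-assoc _ _ z))))

    ∼-+-cong : ∀ {x y u v} → x ∼ y → u ∼ v → x + u ∼ y + v
    ∼-+-cong {x} {y} {u} {v} p q = from (+-closed p q)
      (trans (+-cong (to x y) (to u v))
        (solve 4 (λ i y j v → (i :+ y) :+ (j :+ v) := (i :+ j) :+ (y :+ v)) refl
          (x + - y) y (u + - v) v))

    ∼-*-cong : ∀ {x y u v} → x ∼ y → u ∼ v → x * u ∼ y * v
    ∼-*-cong {x} {y} {u} {v} p q = from (+-closed (*-closed u p) (*-closed y q)) (begin
      x * u                                  ≈⟨ *-congʳ (to x y) ⟩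
      (x + - y + y) * u                      ≈⟨ distribʳ u (x + - y) y ⟩
      (x + - y) * u + y * u                  ≈⟨ +-congˡ (*-congˡ (to u v)) ⟩
      (x + - y) * u + y * (u + - v + v)      ≈⟨ solve 5 (λ i y u j v →
                                                  i :* u :+ y :* (j :+ v) :=
                                                  (u :* i :+ y :* j) :+ y :* v) refl
                                                  (x + - y) y u (u + - v) v ⟩
      u * (x + - y) + y * (u + - v) + y * v  ∎)

    ∼-neg-cong : ∀ {x y} → x ∼ y → - x ∼ - y
    ∼-neg-cong {x} {y} p = resp (sym (-‿+-comm x (- y))) (-‿closed p)

    x-0≈x : ∀ x → x + - 0# ≈ x
    x-0≈x x = trans (+-congˡ -0#≈0#) (+-identityʳ x)

  abstract
    quotientRing-laws : IsCommutativeRing _∼_ _+_ _*_ -_ 0# 1#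
    quotientRing-laws = record
      { isRing = record
        { +-isAbelianGroup = record
          { isGroup = record
            { isMonoid = record
              { isSemigroup = record
                { isMagma = record
                  { isEquivalence = record { refl = of-≈ refl ; sym = ∼-sym ; trans = ∼-trans }
                  ; ∙-cong = ∼-+-cong }
                ; assoc = λ x y z → of-≈ (+-assoc x y z) }
              ; identity = (λ x → of-≈ (+-identityˡ x)) , (λ x → of-≈ (+-identityʳ x)) }
            ; inverse = (λ x → of-≈ (-‿inverseˡ x)) , (λ x → of-≈ (-‿inverseʳ x))
            ; ⁻¹-cong = ∼-neg-cong }
          ; comm = λ x y → of-≈ (+-comm x y) }
        ; *-cong = ∼-*-cong
        ; *-assoc = λ x y z → of-≈ (*-assoc x y z)
        ; *-identity = (λ x → of-≈ (*-identityˡ x)) , (λ x → of-≈ (*-identityʳ x))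
        ; distrib = (λ x y z → of-≈ (distribˡ x y z)) , (λ x y z → of-≈ (distribʳ x y z)) }
      ; *-comm = λ x y → of-≈ (*-comm x y) }

  quotientRing : CRing ℓ
  quotientRing = record
    { Carrier = Elt R
    ; _≈_ = _∼_
    ; _+_ = _+_ ; _*_ = _*_ ; -_ = -_ ; 0# = 0# ; 1# = 1#
    ; isCommutativeRing = quotientRing-laws }

  projection : R ⟶ quotientRing
  projection = mkHom id of-≈
    (λ _ _ → of-≈ refl) (λ _ _ → of-≈ refl) (of-≈ refl)

  abstract
    quotient-isDomain : IsPrime R I → IsDomain quotientRing
    quotient-isDomain prime = record
      { 1≉0 = λ p → proper (resp (x-0≈x 1#) p)
      ; no-zero-divisors = λ p → [ (λ q → inj₁ (resp (sym (x-0≈x _)) q))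
                                 , (λ q → inj₂ (resp (sym (x-0≈x _)) q)) ]′
                                 (split (resp (x-0≈x _) p)) }
      where open IsPrime prime

module _ {R : CRing ℓ} {M : Pred (Elt R) ℓ} (M-mult : IsMultiplicative R M) where
  open CommutativeRing R
  open IsMultiplicative M-mult

  record Fraction : Set ℓ where
    constructor _/_[_]
    field
      num   : Elt R
      den   : Elt R
      den∈M : den ∈ M

  open Fraction

  infix 4 _∼_
  record _∼_ (x y : Fraction) : Set ℓ where
    constructor scaled-by
    field
      scalar   : Elt R
      scalar∈M : scalar ∈ M
      equal    : scalar * (num x * den y) ≈ scalar * (num y * den x)

  private
    open import Algebra.Properties.Ring ring using (-‿distribˡ-*; -‿distribʳ-*)
    open import Algebra.Solver.Ring.NaturalCoefficients.Default commutativeSemiring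
      using (solve; _:=_; _:+_; _:*_; con)
    open import Relation.Binary.Reasoning.Setoid setoid

    of-≈ : ∀ {x y} → num x * den y ≈ num y * den x → x ∼ y
    of-≈ p = scaled-by 1# 1-closed (*-congˡ p)

    ∼-trans : ∀ {x y z} → x ∼ y → y ∼ z → x ∼ z
    ∼-trans {a / b [ _ ]} {c / d [ d∈M ]} {e / f [ _ ]} (scaled-by u u∈M p) (scaled-by v v∈M q) =
      scaled-by (u * v * d) (*-closed (*-closed u∈M v∈M) d∈M) (begin
        u * v * d * (a * f)    ≈⟨ solve 5 (λ u v d a f → u :* v :* d :* (a :* f) :=
                                    v :* f :* (u :* (a :* d))) refl u v d a f ⟩
        v * f * (u * (a * d))  ≈⟨ *-congˡ p ⟩
        v * f * (u * (c * b))  ≈⟨ solve 5 (λ u v f c b → v :* f :* (u :* (c :* b)) :=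
                                    u :* b :* (v :* (c :* f))) refl u v f c b ⟩
        u * b * (v * (c * f))  ≈⟨ *-congˡ q ⟩
        u * b * (v * (e * d))  ≈⟨ solve 5 (λ u v d e b → u :* b :* (v :* (e :* d)) :=
                                    u :* v :* d :* (e :* b)) refl u v d e b ⟩
        u * v * d * (e * b)    ∎)

    _+′_ _*′_ : Fraction → Fraction → Fraction
    (a / b [ p ]) +′ (c / d [ q ]) = (a * d + c * b) / (b * d) [ *-closed p q ]
    (a / b [ p ]) *′ (c / d [ q ]) = (a * c) / (b * d) [ *-closed p q ]

    -′_ : Fraction → Fraction
    -′ (a / b [ p ]) = (- a) / b [ p ]

    +′-cong : ∀ {x y z w} → x ∼ y → z ∼ w → (x +′ z) ∼ (y +′ w)
    +′-cong {a / b [ _ ]} {c / d [ _ ]} {e / f [ _ ]} {g / h [ _ ]} (scaled-by u u∈M p) (scaled-by v v∈M q) =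
      scaled-by (u * v) (*-closed u∈M v∈M) (begin
        u * v * ((a * f + e * b) * (d * h))
          ≈⟨ solve 8 (λ u v a f e b d h → u :* v :* ((a :* f :+ e :* b) :* (d :* h)) :=
               v :* f :* h :* (u :* (a :* d)) :+ u :* b :* d :* (v :* (e :* h))) refl u v a f e b d h ⟩
        v * f * h * (u * (a * d)) + u * b * d * (v * (e * h))
          ≈⟨ +-cong (*-congˡ p) (*-congˡ q) ⟩
        v * f * h * (u * (c * b)) + u * b * d * (v * (g * f))
          ≈⟨ solve 8 (λ u v c f g b d h → v :* f :* h :* (u :* (c :* b)) :+ u :* b :* d :* (v :* (g :* f)) :=
               u :* v :* ((c :* h :+ g :* d) :* (b :* f))) refl u v c f g b d h ⟩
        u * v * ((c * h + g * d) * (b * f)) ∎)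

    *′-cong : ∀ {x y z w} → x ∼ y → z ∼ w → (x *′ z) ∼ (y *′ w)
    *′-cong {a / b [ _ ]} {c / d [ _ ]} {e / f [ _ ]} {g / h [ _ ]} (scaled-by u u∈M p) (scaled-by v v∈M q) =
      scaled-by (u * v) (*-closed u∈M v∈M) (begin
        u * v * (a * e * (d * h))          ≈⟨ solve 6 (λ u v a e d h → u :* v :* (a :* e :* (d :* h)) :=
                                                u :* (a :* d) :* (v :* (e :* h))) refl u v a e d h ⟩
        u * (a * d) * (v * (e * h))        ≈⟨ *-cong p q ⟩
        u * (c * b) * (v * (g * f))        ≈⟨ solve 6 (λ u v c g b f → u :* (c :* b) :* (v :* (g :* f)) :=
                                                u :* v :* (c :* g :* (b :* f))) refl u v c g b f ⟩
        u * v * (c * g * (b * f))          ∎)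

    -′-cong : ∀ {x y} → x ∼ y → (-′ x) ∼ (-′ y)
    -′-cong {a / b [ _ ]} {c / d [ _ ]} (scaled-by u u∈M p) = scaled-by u u∈M (begin
      u * (- a * d)    ≈⟨ *-congˡ (-‿distribˡ-* a d) ⟨
      u * - (a * d)    ≈⟨ -‿distribʳ-* u (a * d) ⟨
      - (u * (a * d))  ≈⟨ -‿cong p ⟩
      - (u * (c * b))  ≈⟨ -‿distribʳ-* u (c * b) ⟩
      u * - (c * b)    ≈⟨ *-congˡ (-‿distribˡ-* c b) ⟩
      u * (- c * b)    ∎)

    inverseˡ : ∀ x → ((-′ x) +′ x) ∼ (0# / 1# [ 1-closed ])
    inverseˡ (a / b [ _ ]) = of-≈ (begin
      (- a * b + a * b) * 1#  ≈⟨ *-identityʳ _ ⟩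
      - a * b + a * b         ≈⟨ distribʳ b (- a) a ⟨
      (- a + a) * b           ≈⟨ *-congʳ (-‿inverseˡ a) ⟩
      0# * b                  ≈⟨ zeroˡ b ⟩
      0#                      ≈⟨ zeroˡ (b * b) ⟨
      0# * (b * b)            ∎)

    +′-comm : ∀ x y → (x +′ y) ∼ (y +′ x)
    +′-comm (a / b [ _ ]) (c / d [ _ ]) = of-≈ (solve 4 (λ a b c d →
      (a :* d :+ c :* b) :* (d :* b) := (c :* b :+ a :* d) :* (b :* d)) refl a b c d)

    +′-identityˡ : ∀ x → ((0# / 1# [ 1-closed ]) +′ x) ∼ x
    +′-identityˡ (a / b [ _ ]) = of-≈ (solve 2 (λ a b →
      (con 0 :* b :+ a :* con 1) :* b := a :* (con 1 :* b)) refl a b)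

    *′-comm : ∀ x y → (x *′ y) ∼ (y *′ x)
    *′-comm (a / b [ _ ]) (c / d [ _ ]) = of-≈ (solve 4 (λ a b c d →
      (a :* c) :* (d :* b) := (c :* a) :* (b :* d)) refl a b c d)

    *′-identityˡ : ∀ x → ((1# / 1# [ 1-closed ]) *′ x) ∼ x
    *′-identityˡ (a / b [ _ ]) = of-≈ (solve 2 (λ a b →
      (con 1 :* a) :* b := a :* (con 1 :* b)) refl a b)

    distribˡ′ : ∀ x y z → (x *′ (y +′ z)) ∼ ((x *′ y) +′ (x *′ z))
    distribˡ′ (a / b [ _ ]) (c / d [ _ ]) (e / f [ _ ]) = of-≈ (solve 6 (λ a b c d e f →
      (a :* (c :* f :+ e :* d)) :* ((b :* d) :* (b :* f)) :=
      ((a :* c) :* (b :* f) :+ (a :* e) :* (b :* d)) :* (b :* (d :* f))) refl a b c d e f)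

  abstract
    localization-laws : IsCommutativeRing _∼_ _+′_ _*′_ -′_ (0# / 1# [ 1-closed ]) (1# / 1# [ 1-closed ])
    localization-laws = record
      { isRing = record
        { +-isAbelianGroup = record
          { isGroup = record
            { isMonoid = record
              { isSemigroup = record
                { isMagma = record
                  { isEquivalence = record
                    { refl = of-≈ refl
                    ; sym = λ (scaled-by u u∈M p) → scaled-by u u∈M (sym p)
                    ; trans = ∼-trans }
                  ; ∙-cong = +′-cong }
                ; assoc = λ (a / b [ _ ]) (c / d [ _ ]) (e / f [ _ ]) → of-≈ (solve 6 (λ a b c d e f →
                    ((a :* d :+ c :* b) :* f :+ e :* (b :* d)) :* (b :* (d :* f)) :=
                    (a :* (d :* f) :+ (c :* f :+ e :* d) :* b) :* (b :* d :* f)) refl a b c d e f) }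
              ; identity = +′-identityˡ , λ x →
                  ∼-trans (+′-comm x _) (+′-identityˡ x) }
            ; inverse = inverseˡ , λ x →
                ∼-trans (+′-comm x (-′ x)) (inverseˡ x)
            ; ⁻¹-cong = -′-cong }
          ; comm = +′-comm }
        ; *-cong = *′-cong
        ; *-assoc = λ (a / b [ _ ]) (c / d [ _ ]) (e / f [ _ ]) → of-≈ (solve 6 (λ a b c d e f →
            ((a :* c) :* e) :* (b :* (d :* f)) := (a :* (c :* e)) :* (b :* d :* f)) refl a b c d e f)
        ; *-identity = *′-identityˡ , λ x →
            ∼-trans (*′-comm x _) (*′-identityˡ x)
        ; distrib = distribˡ′ , λ x y z →
            ∼-trans (*′-comm (y +′ z) x)
              (∼-trans (distribˡ′ x y z)
                (+′-cong (*′-comm x y) (*′-comm x z))) }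
      ; *-comm = *′-comm }

  localization : CRing ℓ
  localization = record
    { Carrier = Fraction
    ; _≈_ = _∼_
    ; _+_ = _+′_ ; _*_ = _*′_ ; -_ = -′_ ; 0# = 0# / 1# [ 1-closed ] ; 1# = 1# / 1# [ 1-closed ]
    ; isCommutativeRing = localization-laws }

  localize : R ⟶ localization
  localize = mkHom (λ x → x / 1# [ 1-closed ])
    (λ p → of-≈ (*-congʳ p))
    (λ x y → of-≈ (solve 2 (λ x y → (x :+ y) :* (con 1 :* con 1) :=
      (x :* con 1 :+ y :* con 1) :* con 1) refl x y))
    (λ x y → of-≈ (solve 2 (λ x y → (x :* y) :* (con 1 :* con 1) := (x :* y) :* con 1) refl x y))
    (of-≈ refl)

module _ {R : CRing ℓ} (R-domain : IsDomain R) where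
  open CommutativeRing R
  open IsDomain R-domain

  nonzero-multiplicative : IsMultiplicative R (λ x → ¬ x ≈ 0#)
  nonzero-multiplicative = record
    { 1-closed = 1≉0
    ; *-closed = λ x≉0 y≉0 xy≈0 → [ x≉0 , y≉0 ]′ (no-zero-divisors xy≈0) }

  fractionField : CRing ℓ
  fractionField = localization {R = R} nonzero-multiplicative

module _ {R : CRing ℓ} {𝔭 : Ideal R} (prime : IsPrime R 𝔭) where
  open IsPrime prime

  complement-multiplicative : IsMultiplicative R (λ x → x ∉ member 𝔭)
  complement-multiplicative = record
    { 1-closed = proper
    ; *-closed = λ x∉𝔭 y∉𝔭 xy∈𝔭 → [ x∉𝔭 , y∉𝔭 ]′ (split xy∈𝔭) }

  localizationAt : CRing ℓ
  localizationAt = localization {R = R} complement-multiplicative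

  localizeAt : R ⟶ localizationAt
  localizeAt = localize complement-multiplicative

  residueFieldAt : CRing ℓ
  residueFieldAt = fractionField (quotient-isDomain 𝔭 prime)

  toResidueFieldAt : R ⟶ residueFieldAt
  toResidueFieldAt =
    localize (nonzero-multiplicative (quotient-isDomain 𝔭 prime)) ⊙ projection 𝔭

module _ {R S : CRing ℓ} (h : R ⟶ S) where
  private
    module R = CommutativeRing R
    module h = _⟶_ h
  open CommutativeRing S

  kernel : Ideal R
  kernel = record
    { member   = λ x → h ⟨$⟩ x ≈ 0#
    ; resp     = λ p q → trans (sym (h.⟦⟧-cong p)) q
    ; 0-closed = h.0#-homo
    ; +-closed = λ p q → trans (h.+-homo _ _) (trans (+-cong p q) (+-identityˡ 0#))
    ; *-closed = λ _ p → trans (h.*-homo _ _) (trans (*-congˡ p) (zeroʳ _)) }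

  abstract
    kernel-isPrime : IsDomain S → IsPrime R kernel
    kernel-isPrime S-domain = record
      { proper = λ p → 1≉0 (trans (sym h.1#-homo) p)
      ; split  = λ p → no-zero-divisors (trans (sym (h.*-homo _ _)) p) }
      where open IsDomain S-domain

-- The commutative ring with generators G and relations _⇝_.  Polynomial rings,
-- integral monoid rings and tensor products are all obtained as instances.

infixl 6 _⊕_
infixl 7 _⊗_
data Term (G : Set ℓ) : Set ℓ where
  gen     : G → Term G
  _⊕_ _⊗_ : Term G → Term G → Term G
  ⊖_      : Term G → Term G
  𝟘 𝟙     : Term G

module _ {G : Set ℓ} (_⇝_ : Rel (Term G) ℓ) where

  infix 4 _≋_
  data _≋_ : Rel (Term G) ℓ where
    rel         : ∀ {x y} → x ⇝ y → x ≋ y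
    ≋-refl      : ∀ {x} → x ≋ x
    ≋-sym       : ∀ {x y} → x ≋ y → y ≋ x
    ≋-trans     : ∀ {x y z} → x ≋ y → y ≋ z → x ≋ z
    ⊕-cong      : ∀ {x y u v} → x ≋ y → u ≋ v → x ⊕ u ≋ y ⊕ v
    ⊗-cong      : ∀ {x y u v} → x ≋ y → u ≋ v → x ⊗ u ≋ y ⊗ v
    ⊖-cong      : ∀ {x y} → x ≋ y → ⊖ x ≋ ⊖ y
    ⊕-assoc     : ∀ x y z → (x ⊕ y) ⊕ z ≋ x ⊕ (y ⊕ z)
    ⊕-comm      : ∀ x y → x ⊕ y ≋ y ⊕ x
    ⊕-identityˡ : ∀ x → 𝟘 ⊕ x ≋ x
    ⊖-inverseˡ  : ∀ x → ⊖ x ⊕ x ≋ 𝟘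
    ⊗-assoc     : ∀ x y z → (x ⊗ y) ⊗ z ≋ x ⊗ (y ⊗ z)
    ⊗-comm      : ∀ x y → x ⊗ y ≋ y ⊗ x
    ⊗-identityˡ : ∀ x → 𝟙 ⊗ x ≋ x
    distribʳ    : ∀ x y z → (y ⊕ z) ⊗ x ≋ y ⊗ x ⊕ z ⊗ x

  abstract
    presented-laws : IsCommutativeRing _≋_ _⊕_ _⊗_ ⊖_ 𝟘 𝟙
    presented-laws = record
      { isRing = record
        { +-isAbelianGroup = record
          { isGroup = record
            { isMonoid = record
              { isSemigroup = record
                { isMagma = record
                  { isEquivalence = record { refl = ≋-refl ; sym = ≋-sym ; trans = ≋-trans }
                  ; ∙-cong = ⊕-cong }
                ; assoc = ⊕-assoc }
              ; identity = ⊕-identityˡ , λ x → ≋-trans (⊕-comm x 𝟘) (⊕-identityˡ x) }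
            ; inverse = ⊖-inverseˡ , λ x → ≋-trans (⊕-comm x (⊖ x)) (⊖-inverseˡ x)
            ; ⁻¹-cong = ⊖-cong }
          ; comm = ⊕-comm }
        ; *-cong = ⊗-cong
        ; *-assoc = ⊗-assoc
        ; *-identity = ⊗-identityˡ , λ x → ≋-trans (⊗-comm x 𝟙) (⊗-identityˡ x)
        ; distrib = (λ x y z → ≋-trans (⊗-comm x (y ⊕ z))
                      (≋-trans (distribʳ x y z) (⊕-cong (⊗-comm y x) (⊗-comm z x))))
                  , distribʳ }
      ; *-comm = ⊗-comm }

  presented : CRing ℓ
  presented = record
    { Carrier = Term G
    ; _≈_ = _≋_ ; _+_ = _⊕_ ; _*_ = _⊗_ ; -_ = ⊖_ ; 0# = 𝟘 ; 1# = 𝟙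
    ; isCommutativeRing = presented-laws }

  module _ {S : CRing ℓ} (ρ : G → Elt S) where
    private module S = CommutativeRing S

    interpret : Term G → Elt S
    interpret (gen g) = ρ g
    interpret (s ⊕ t) = interpret s S.+ interpret t
    interpret (s ⊗ t) = interpret s S.* interpret t
    interpret (⊖ t)   = S.- interpret t
    interpret 𝟘       = S.0#
    interpret 𝟙       = S.1#

    interpretHom : (∀ {s t} → s ⇝ t → interpret s S.≈ interpret t) → presented ⟶ S
    interpretHom ρ-rel = mkHom interpret cong
      (λ _ _ → S.refl) (λ _ _ → S.refl) S.refl
      where
      cong : ∀ {s t} → s ≋ t → interpret s S.≈ interpret t
      cong (rel p)           = ρ-rel p
      cong ≋-refl            = S.refl
      cong (≋-sym p)         = S.sym (cong p)
      cong (≋-trans p q)     = S.trans (cong p) (cong q)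
      cong (⊕-cong p q)      = S.+-cong (cong p) (cong q)
      cong (⊗-cong p q)      = S.*-cong (cong p) (cong q)
      cong (⊖-cong p)        = S.-‿cong (cong p)
      cong (⊕-assoc x y z)   = S.+-assoc _ _ _
      cong (⊕-comm x y)      = S.+-comm _ _
      cong (⊕-identityˡ x)   = S.+-identityˡ _
      cong (⊖-inverseˡ x)    = S.-‿inverseˡ _
      cong (⊗-assoc x y z)   = S.*-assoc _ _ _
      cong (⊗-comm x y)      = S.*-comm _ _
      cong (⊗-identityˡ x)   = S.*-identityˡ _
      cong (distribʳ x y z)  = S.distribʳ _ _ _

module _ (R : CRing ℓ) (X : Set) where
  open CommutativeRing R

  data PolynomialRelation : Rel (Term (Elt R ⊎ X)) ℓ where
    con-cong : ∀ {a b} → a ≈ b → PolynomialRelation (gen (inj₁ a)) (gen (inj₁ b))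
    con-+    : ∀ a b → PolynomialRelation (gen (inj₁ (a + b))) (gen (inj₁ a) ⊕ gen (inj₁ b))
    con-*    : ∀ a b → PolynomialRelation (gen (inj₁ (a * b))) (gen (inj₁ a) ⊗ gen (inj₁ b))
    con-1    : PolynomialRelation (gen (inj₁ 1#)) 𝟙

  infix 21 _[_]
  _[_] : CRing ℓ
  _[_] = presented PolynomialRelation

module _ {R : CRing ℓ} {X : Set} where

  con : R ⟶ R [ X ]
  con = mkHom (λ a → gen (inj₁ a)) (λ p → rel (con-cong p))
    (λ a b → rel (con-+ a b)) (λ a b → rel (con-* a b)) (rel con-1)

  var : X → Elt (R [ X ])
  var x = gen (inj₂ x)

  evaluate : {S : CRing ℓ} → R ⟶ S → (X → Elt S) → R [ X ] ⟶ S
  evaluate {S = S} h ρ = interpretHom (PolynomialRelation R X) {S = S} [ h ⟨$⟩_ , ρ ]′ λ where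
      (con-cong p) → h.⟦⟧-cong p
      (con-+ a b)  → h.+-homo a b
      (con-* a b)  → h.*-homo a b
      con-1        → h.1#-homo
    where module h = _⟶_ h

mapCoefficients : {R S : CRing ℓ} {X : Set} → R ⟶ S → R [ X ] ⟶ S [ X ]
mapCoefficients {S = S} h = evaluate (con ⊙ h) (var {R = S})

-- B ⊗_Z C is the pushout of B ← Z → C.  The relations involve only the elements
-- of Z, so Z is not required to carry a ring structure.
module _ (B C : CRing ℓ) {Z : Set ℓ} (β : Z → Elt B) (γ : Z → Elt C) where
  private
    module B = CommutativeRing B
    module C = CommutativeRing C

  data TensorRelation : Rel (Term (Elt B ⊎ Elt C)) ℓ where
    left-cong  : ∀ {x y} → x B.≈ y → TensorRelation (gen (inj₁ x)) (gen (inj₁ y))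
    left-+     : ∀ x y → TensorRelation (gen (inj₁ (x B.+ y))) (gen (inj₁ x) ⊕ gen (inj₁ y))
    left-*     : ∀ x y → TensorRelation (gen (inj₁ (x B.* y))) (gen (inj₁ x) ⊗ gen (inj₁ y))
    left-1     : TensorRelation (gen (inj₁ B.1#)) 𝟙
    right-cong : ∀ {x y} → x C.≈ y → TensorRelation (gen (inj₂ x)) (gen (inj₂ y))
    right-+    : ∀ x y → TensorRelation (gen (inj₂ (x C.+ y))) (gen (inj₂ x) ⊕ gen (inj₂ y))
    right-*    : ∀ x y → TensorRelation (gen (inj₂ (x C.* y))) (gen (inj₂ x) ⊗ gen (inj₂ y))
    right-1    : TensorRelation (gen (inj₂ C.1#)) 𝟙
    balanced   : ∀ z → TensorRelation (gen (inj₁ (β z))) (gen (inj₂ (γ z)))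

  tensor : CRing ℓ
  tensor = presented TensorRelation

  tensor-left : B ⟶ tensor
  tensor-left = mkHom (λ x → gen (inj₁ x)) (λ p → rel (left-cong p))
    (λ x y → rel (left-+ x y)) (λ x y → rel (left-* x y)) (rel left-1)

  tensor-right : C ⟶ tensor
  tensor-right = mkHom (λ x → gen (inj₂ x)) (λ p → rel (right-cong p))
    (λ x y → rel (right-+ x y)) (λ x y → rel (right-* x y)) (rel right-1)

  tensor-universal : {D : CRing ℓ} (f : B ⟶ D) (g : C ⟶ D) →
                     (∀ z → CommutativeRing._≈_ D (f ⟨$⟩ β z) (g ⟨$⟩ γ z)) → tensor ⟶ D
  tensor-universal {D = D} f g compatible =
    interpretHom TensorRelation {S = D} [ f ⟨$⟩_ , g ⟨$⟩_ ]′ λ where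
      (left-cong p)  → f.⟦⟧-cong p
      (left-+ x y)   → f.+-homo x y
      (left-* x y)   → f.*-homo x y
      left-1         → f.1#-homo
      (right-cong p) → g.⟦⟧-cong p
      (right-+ x y)  → g.+-homo x y
      (right-* x y)  → g.*-homo x y
      right-1        → g.1#-homo
      (balanced z)   → compatible z
    where
    module f = _⟶_ f
    module g = _⟶_ g

-- Univariate polynomials.

Poly : CRing ℓ → CRing ℓ
Poly R = R [ ⊤ ]

evaluateAt : {R S : CRing ℓ} → R ⟶ S → Elt S → Poly R ⟶ S
evaluateAt h x = evaluate h (const x)

module _ (R : CRing ℓ) where
  open CommutativeRing (Poly R)
  open Arithmetic (Poly R) using (_^_; sum; product; Coprime)

  private
    X : Elt (Poly R)
    X = var {R = R} tt

    c : R ⟶ Poly R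
    c = con {R = R}

  derivative : Elt (Poly R) → Elt (Poly R)
  derivative (gen (inj₁ _)) = 𝟘
  derivative (gen (inj₂ _)) = 𝟙
  derivative (f ⊕ g)        = derivative f ⊕ derivative g
  derivative (f ⊗ g)        = derivative f ⊗ g ⊕ f ⊗ derivative g
  derivative (⊖ f)          = ⊖ derivative f
  derivative 𝟘              = 𝟘
  derivative 𝟙              = 𝟘

  IsMonic : Pred (Elt (Poly R)) ℓ
  IsMonic f = ∃[ n ] Σ[ a ∈ (Fin n → Elt R) ]
    f ≈ X ^ n + sum (λ i → c ⟨$⟩ a i * X ^ toℕ i)

  IsConstant : Pred (Elt (Poly R)) ℓ
  IsConstant f = ∃[ a ] f ≈ c ⟨$⟩ a

  IsSeparablePolynomial : Pred (Elt (Poly R)) ℓ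
  IsSeparablePolynomial f = Coprime f (derivative f)

  Splits : Pred (Elt (Poly R)) ℓ
  Splits f = ∃[ u ] ∃[ n ] Σ[ a ∈ (Fin n → Elt R) ]
    f ≈ c ⟨$⟩ u * product (λ i → X - c ⟨$⟩ a i)

module _ {R S : CRing ℓ} (h : R ⟶ S) where
  open CommutativeRing S
  open Arithmetic S using (sum)

  IsRoot : Elt (Poly R) → Pred (Elt S) ℓ
  IsRoot f x = evaluateAt h x ⟨$⟩ f ≈ 0#

  IsIntegral : Pred (Elt S) ℓ
  IsIntegral x = ∃[ f ] IsMonic R f × IsRoot f x

  -- The minimal polynomial of x, unique up to a unit, is separable.
  IsSeparableElement : Pred (Elt S) ℓ
  IsSeparableElement x =
    ∃[ f ] Arithmetic.Irreducible (Poly R) f × IsSeparablePolynomial R f × IsRoot f x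

  HasDegree : ℕ → Set ℓ
  HasDegree n = Σ[ b ∈ (Fin n → Elt S) ] ∀ x → Σ[ c ∈ (Fin n → Elt R) ]
    x ≈ sum (λ i → h ⟨$⟩ c i * b i) ×
    (∀ (c′ : Fin n → Elt R) → x ≈ sum (λ i → h ⟨$⟩ c′ i * b i) → ∀ i → CommutativeRing._≈_ R (c′ i) (c i))

  IsLocalHom : Set ℓ
  IsLocalHom = ∀ x → IsUnit S (h ⟨$⟩ x) → IsUnit R x

module _ (R : CRing ℓ) where
  open CommutativeRing R
  private
    𝟏 : R ⟶ R
    𝟏 = idHom

  record IsHenselian : Set ℓ where
    field
      isLocal : IsLocal R
      lift    : ∀ f → IsMonic R f → ∀ a →
                ¬ IsUnit R (evaluateAt 𝟏 a ⟨$⟩ f) →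
                IsUnit R (evaluateAt 𝟏 a ⟨$⟩ derivative R f) →
                ∃[ b ] IsRoot 𝟏 f b × ¬ IsUnit R (b - a)

module _ {R : CRing ℓ} where
  open CommutativeRing R

  unit-resp : ∀ {x y} → x ≈ y → IsUnit R x → IsUnit R y
  unit-resp p (q ⸴ e) = q ⸴ trans (*-congˡ (sym p)) e

  maximalIdeal : IsLocal R → Ideal R
  maximalIdeal R-local = record
    { member = λ x → ¬ IsUnit R x
    ; resp = λ p x∉ y∈ → x∉ (unit-resp (sym p) y∈)
    ; 0-closed = 0-nonunit
    ; +-closed = +-nonunit
    ; *-closed = λ { x {y} y∉ (q ⸴ e) →
        y∉ (q * x ⸴ trans (*-assoc q x y) e) } }
    where open IsLocal R-local

  residueField : IsLocal R → CRing ℓ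
  residueField R-local = quotientRing (maximalIdeal R-local)

residueHom : {R S : CRing ℓ} {h : R ⟶ S} → IsLocalHom h →
             (R-local : IsLocal R) (S-local : IsLocal S) →
             residueField R-local ⟶ residueField S-local
residueHom {R = R} {S} {h} h-local R-local S-local = mkHom (h ⟨$⟩_)
  (λ {x} {y} x-y∉ u → x-y∉ (h-local (x R.+ R.- y)
    (unit-resp {R = S} (S.sym (S.trans (h.+-homo x (R.- y)) (S.+-congˡ (h.-‿homo y)))) u)))
  (λ x y → projection-cong (h.+-homo x y))
  (λ x y → projection-cong (h.*-homo x y))
  (projection-cong h.1#-homo)
  where
  module R = CommutativeRing R
  module S = CommutativeRing S
  module h = _⟶_ h
  projection-cong : ∀ {x y} → x S.≈ y → CommutativeRing._≈_ (residueField S-local) x y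
  projection-cong = _⟶_.⟦⟧-cong (projection (maximalIdeal S-local))

-- Groups are written multiplicatively.

infix 4 _⟶ᴳ_
record _⟶ᴳ_ (G H : AbelianGroup ℓ ℓ) : Set ℓ where
  constructor homᴳ
  field
    groupHomomorphism : GroupHomomorphism (AbelianGroup.rawGroup G) (AbelianGroup.rawGroup H)
  open GroupHomomorphism groupHomomorphism public renaming (⟦_⟧ to infixl 20 _⟨$⟩ᴳ_)

open _⟶ᴳ_ public using (_⟨$⟩ᴳ_)

module _ {G H : AbelianGroup ℓ ℓ} where
  private
    module G = AbelianGroup G
    module H = AbelianGroup H
  open import Algebra.Properties.Group H.group using (identityʳ-unique; inverseˡ-unique)

  module _ (f : G.Carrier → H.Carrier)
           (f-cong : ∀ {x y} → x G.≈ y → f x H.≈ f y)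
           (f-∙ : ∀ x y → f (x G.∙ y) H.≈ f x H.∙ f y) where
    abstract
      mkHomᴳ-laws : GroupMorphisms.IsGroupHomomorphism G.rawGroup H.rawGroup f
      mkHomᴳ-laws = record
        { isMonoidHomomorphism = record
          { isMagmaHomomorphism = record
            { isRelHomomorphism = record { cong = f-cong }
            ; homo = f-∙ }
          ; ε-homo = f-ε }
        ; ⁻¹-homo = λ x → inverseˡ-unique (f (x G.⁻¹)) (f x)
            (H.trans (H.sym (f-∙ (x G.⁻¹) x)) (H.trans (f-cong (G.inverseˡ x)) f-ε)) }
        where
        f-ε : f G.ε H.≈ H.ε
        f-ε = identityʳ-unique (f G.ε) (f G.ε)
          (H.trans (H.sym (f-∙ G.ε G.ε)) (f-cong (G.identityˡ G.ε)))

    mkHomᴳ : G ⟶ᴳ H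
    mkHomᴳ = homᴳ (record { ⟦_⟧ = f ; isGroupHomomorphism = mkHomᴳ-laws })

module _ {G H : AbelianGroup ℓ ℓ} (h : G ⟶ᴳ H) where
  private
    module G = AbelianGroup G
  open AbelianGroup H
  open _⟶ᴳ_ h using (ε-homo; homo; ⁻¹-homo)
  open import Algebra.Properties.AbelianGroup H using (⁻¹-∙-comm)
  open import Algebra.Properties.CommutativeSemigroup commutativeSemigroup using (interchange)
  open import Relation.Binary.Reasoning.Setoid setoid

  private
    infix 4 _∼ᴳ_
    _∼ᴳ_ : Rel Carrier _
    x ∼ᴳ y = ∃[ g ] x ≈ h ⟨$⟩ᴳ g ∙ y

    of-≈ : ∀ {x y} → x ≈ y → x ∼ᴳ y
    of-≈ {x} {y} p = G.ε , trans p (sym (trans (∙-congʳ ε-homo) (identityˡ y)))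

    ∼ᴳ-sym : ∀ {x y} → x ∼ᴳ y → y ∼ᴳ x
    ∼ᴳ-sym {x} {y} (g , p) = g G.⁻¹ , (begin
      y                                      ≈⟨ identityˡ y ⟨
      ε ∙ y                                  ≈⟨ ∙-congʳ (inverseˡ (h ⟨$⟩ᴳ g)) ⟨
      (h ⟨$⟩ᴳ g) ⁻¹ ∙ h ⟨$⟩ᴳ g ∙ y           ≈⟨ assoc _ _ y ⟩
      (h ⟨$⟩ᴳ g) ⁻¹ ∙ (h ⟨$⟩ᴳ g ∙ y)         ≈⟨ ∙-cong (⁻¹-homo g) p ⟨
      h ⟨$⟩ᴳ (g G.⁻¹) ∙ x                    ∎)

    ∼ᴳ-trans : ∀ {x y z} → x ∼ᴳ y → y ∼ᴳ z → x ∼ᴳ z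
    ∼ᴳ-trans {x} {y} {z} (g , p) (g′ , q) = g G.∙ g′ , (begin
      x                                  ≈⟨ p ⟩
      h ⟨$⟩ᴳ g ∙ y                       ≈⟨ ∙-congˡ q ⟩
      h ⟨$⟩ᴳ g ∙ (h ⟨$⟩ᴳ g′ ∙ z)         ≈⟨ assoc _ _ z ⟨
      h ⟨$⟩ᴳ g ∙ h ⟨$⟩ᴳ g′ ∙ z           ≈⟨ ∙-congʳ (homo g g′) ⟨
      h ⟨$⟩ᴳ (g G.∙ g′) ∙ z              ∎)

    ∼ᴳ-cong : ∀ {x y u v} → x ∼ᴳ y → u ∼ᴳ v → x ∙ u ∼ᴳ y ∙ v
    ∼ᴳ-cong {x} {y} {u} {v} (g , p) (g′ , q) = g G.∙ g′ , (begin
      x ∙ u                                  ≈⟨ ∙-cong p q ⟩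
      (h ⟨$⟩ᴳ g ∙ y) ∙ (h ⟨$⟩ᴳ g′ ∙ v)       ≈⟨ interchange _ y _ v ⟩
      (h ⟨$⟩ᴳ g ∙ h ⟨$⟩ᴳ g′) ∙ (y ∙ v)       ≈⟨ ∙-congʳ (homo g g′) ⟨
      h ⟨$⟩ᴳ (g G.∙ g′) ∙ (y ∙ v)            ∎)

    ∼ᴳ-⁻¹-cong : ∀ {x y} → x ∼ᴳ y → x ⁻¹ ∼ᴳ y ⁻¹
    ∼ᴳ-⁻¹-cong {x} {y} (g , p) = g G.⁻¹ , (begin
      x ⁻¹                       ≈⟨ ⁻¹-cong p ⟩
      (h ⟨$⟩ᴳ g ∙ y) ⁻¹          ≈⟨ ⁻¹-∙-comm _ y ⟨
      (h ⟨$⟩ᴳ g) ⁻¹ ∙ y ⁻¹       ≈⟨ ∙-congʳ (⁻¹-homo g) ⟨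
      h ⟨$⟩ᴳ (g G.⁻¹) ∙ y ⁻¹     ∎)

  abstract
    cokernel-laws : IsAbelianGroup _∼ᴳ_ _∙_ ε _⁻¹
    cokernel-laws = record
      { isGroup = record
        { isMonoid = record
          { isSemigroup = record
            { isMagma = record
              { isEquivalence = record { refl = of-≈ refl ; sym = ∼ᴳ-sym ; trans = ∼ᴳ-trans }
              ; ∙-cong = ∼ᴳ-cong }
            ; assoc = λ x y z → of-≈ (assoc x y z) }
          ; identity = (λ x → of-≈ (identityˡ x)) , (λ x → of-≈ (identityʳ x)) }
        ; inverse = (λ x → of-≈ (inverseˡ x)) , (λ x → of-≈ (inverseʳ x))
        ; ⁻¹-cong = ∼ᴳ-⁻¹-cong }
      ; comm = λ x y → of-≈ (comm x y) }

  cokernel : AbelianGroup _ _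
  cokernel = record
    { Carrier = Carrier
    ; _≈_ = _∼ᴳ_ ; _∙_ = _∙_ ; ε = ε ; _⁻¹ = _⁻¹
    ; isAbelianGroup = cokernel-laws }

  toCokernel : H ⟶ᴳ cokernel
  toCokernel = mkHomᴳ id of-≈ (λ _ _ → of-≈ refl)

module _ (G : AbelianGroup ℓ ℓ) where
  open AbelianGroup G
  open Algebra.Definitions.RawMonoid rawMonoid using (sum) renaming (_×_ to _times_)

  power : Carrier → ℤ → Carrier
  power g (+ n)    = n times g
  power g -[1+ n ] = (ℕ.suc n times g) ⁻¹

  FreeOfFiniteRank : Set _
  FreeOfFiniteRank = ∃[ r ] Σ[ b ∈ (Fin r → Carrier) ] ∀ g → Σ[ n ∈ (Fin r → ℤ) ]
    g ≈ sum (λ i → power (b i) (n i)) ×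
    (∀ (n′ : Fin r → ℤ) → g ≈ sum (λ i → power (b i) (n′ i)) → ∀ i → n′ i ≡ n i)

  record HasOrder (n : ℕ) : Set ℓ where
    field
      bijection : Bijection (≡.setoid (Fin n)) setoid

  record IsSubmonoid (P : Pred Carrier ℓ) : Set ℓ where
    field
      resp     : ∀ {x y} → x ≈ y → x ∈ P → y ∈ P
      ε-closed : ε ∈ P
      ∙-closed : ∀ {x y} → x ∈ P → y ∈ P → x ∙ y ∈ P

  -- The units of a submonoid.
  infix 25 _ˣ
  _ˣ : Pred Carrier ℓ → Pred Carrier ℓ
  (P ˣ) x = x ∈ P × x ⁻¹ ∈ P

  record IsValuativeMonoid (P : Pred Carrier ℓ) : Set ℓ where
    field
      isSubmonoid : IsSubmonoid P
      total       : ∀ x → x ∈ P ⊎ x ⁻¹ ∈ P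

  infix 4 _Dominates_
  _Dominates_ : Rel (Pred Carrier ℓ) ℓ
  Q Dominates P = P ⊆ Q × (Q ˣ ∩ P) ≐ P ˣ

module _ {G : AbelianGroup ℓ ℓ} {P : Pred (AbelianGroup.Carrier G) ℓ} (P-submonoid : IsSubmonoid G P) where
  open AbelianGroup G
  open IsSubmonoid P-submonoid

  abstract
    submonoid-laws : IsCommutativeMonoid {A = ∃ P} (λ x y → proj₁ x ≈ proj₁ y)
      (λ x y → proj₁ x ∙ proj₁ y , ∙-closed (proj₂ x) (proj₂ y)) (ε , ε-closed)
    submonoid-laws = record
      { isMonoid = record
        { isSemigroup = record
          { isMagma = record
            { isEquivalence = record { refl = refl ; sym = sym ; trans = trans }
            ; ∙-cong = ∙-cong }
          ; assoc = λ _ _ _ → assoc _ _ _ }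
        ; identity = (λ _ → identityˡ _) , (λ _ → identityʳ _) }
      ; comm = λ _ _ → comm _ _ }

  submonoid : CommutativeMonoid ℓ ℓ
  submonoid = record
    { Carrier = ∃ P
    ; _≈_ = λ x y → proj₁ x ≈ proj₁ y
    ; _∙_ = λ x y → proj₁ x ∙ proj₁ y , ∙-closed (proj₂ x) (proj₂ y)
    ; ε   = ε , ε-closed
    ; isCommutativeMonoid = submonoid-laws }

module _ (R : CRing ℓ) where
  open CommutativeRing R
  open import Algebra.Solver.Ring.NaturalCoefficients.Default commutativeSemiring
    using (solve; _:=_; _:*_)

  abstract
    unit-* : ∀ {x y q r} → q * x ≈ 1# → r * y ≈ 1# → q * r * (x * y) ≈ 1#
    unit-* {x} {y} {q} {r} e f =
      trans (solve 4 (λ q r x y → q :* r :* (x :* y) := q :* x :* (r :* y)) refl q r x y)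
        (trans (*-cong e f) (*-identityˡ 1#))

    unit-⁻¹-cong : ∀ {x y q r} → q * x ≈ 1# → r * y ≈ 1# → x ≈ y → q ≈ r
    unit-⁻¹-cong {x} {y} {q} {r} e f p =
      trans (sym (*-identityʳ q))
      (trans (*-congˡ (sym (trans (*-congˡ p) f)))
      (trans (solve 3 (λ q r x → q :* (r :* x) := q :* x :* r) refl q r x)
      (trans (*-congʳ e) (*-identityˡ r))))

  private
    Unit : Set ℓ
    Unit = ∃ (IsUnit R)

    _≈ˣ_ : Rel Unit ℓ
    x ≈ˣ y = proj₁ x ≈ proj₁ y

    _*ˣ_ : Unit → Unit → Unit
    (x , q ⸴ e) *ˣ (y , r ⸴ f) = x * y , q * r ⸴ unit-* e f

    1ˣ : Unit
    1ˣ = 1# , 1# ⸴ *-identityˡ 1#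

    _⁻¹ˣ : Unit → Unit
    (x , q ⸴ e) ⁻¹ˣ = q , x ⸴ trans (*-comm x q) e

  abstract
    units-laws : IsAbelianGroup _≈ˣ_ _*ˣ_ 1ˣ _⁻¹ˣ
    units-laws = record
      { isGroup = record
        { isMonoid = record
          { isSemigroup = record
            { isMagma = record
              { isEquivalence = record { refl = refl ; sym = sym ; trans = trans }
              ; ∙-cong = *-cong }
            ; assoc = λ _ _ _ → *-assoc _ _ _ }
          ; identity = (λ _ → *-identityˡ _) , (λ _ → *-identityʳ _) }
        ; inverse = (λ (_ , _ ⸴ e) → e) , (λ (x , q ⸴ e) → trans (*-comm x q) e)
        ; ⁻¹-cong = λ {(_ , _ ⸴ e)} {(_ , _ ⸴ f)} p → unit-⁻¹-cong e f p }
      ; comm = λ _ _ → *-comm _ _ }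

  units : AbelianGroup ℓ ℓ
  units = record
    { Carrier = Unit ; _≈_ = _≈ˣ_ ; _∙_ = _*ˣ_ ; ε = 1ˣ ; _⁻¹ = _⁻¹ˣ
    ; isAbelianGroup = units-laws }

unitsHom : {R S : CRing ℓ} → R ⟶ S → units R ⟶ᴳ units S
unitsHom {S = S} h = mkHomᴳ
  (λ (x , q ⸴ e) → h ⟨$⟩ x , h ⟨$⟩ q ⸴ S.trans (S.sym (h.*-homo q x)) (S.trans (h.⟦⟧-cong e) h.1#-homo))
  h.⟦⟧-cong (λ _ _ → h.*-homo _ _)
  where
  module S = CommutativeRing S
  module h = _⟶_ h

module _ (M : CommutativeMonoid ℓ ℓ) where
  open CommutativeMonoid M

  data MonoidRelation : Rel (Term Carrier) ℓ where
    gen-cong : ∀ {x y} → x ≈ y → MonoidRelation (gen x) (gen y)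
    gen-∙    : ∀ x y → MonoidRelation (gen (x ∙ y)) (gen x ⊗ gen y)
    gen-ε    : MonoidRelation (gen ε) 𝟙

  ℤ[_] : CRing ℓ
  ℤ[_] = presented MonoidRelation

  module _ {R : CRing ℓ} where
    open CommutativeRing R using () renaming (_≈_ to _≈ᴿ_; _*_ to _*ᴿ_; 1# to 1ᴿ)

    extendToRing : (f : Carrier → Elt R) →
                   (∀ {x y} → x ≈ y → f x ≈ᴿ f y) →
                   (∀ x y → f (x ∙ y) ≈ᴿ f x *ᴿ f y) →
                   f ε ≈ᴿ 1ᴿ →
                   ℤ[_] ⟶ R
    extendToRing f f-cong f-∙ f-ε = interpretHom MonoidRelation {S = R} f λ where
      (gen-cong p) → f-cong p
      (gen-∙ x y)  → f-∙ x y
      gen-ε        → f-ε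

record HenselianValuationRing ℓ : Set (suc ℓ) where
  field
    K           : CRing ℓ
    K-isField   : IsField K
    𝒜           : Pred (Elt K) ℓ
    𝒜-isSubring : IsSubring K 𝒜

  open CommutativeRing K

  A : CRing ℓ
  A = subring {R = K} 𝒜-isSubring

  A⟶K : A ⟶ K
  A⟶K = inclusion 𝒜-isSubring

  field
    A-isValuationRing : IsValuationRing A
    A-isHenselian     : IsHenselian A
    fractions         : ∀ x → ∃[ a ] ∃[ b ] a ∈ 𝒜 × b ∈ 𝒜 × ¬ b ≈ 0# × x * b ≈ a

  A-isLocal : IsLocal A
  A-isLocal = IsHenselian.isLocal A-isHenselian

  valueGroup : AbelianGroup ℓ ℓ
  valueGroup = cokernel (unitsHom A⟶K)

  -- A ∖ {0}, as a submonoid of the group of units of K.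
  𝒱₀ : Pred (AbelianGroup.Carrier (units K)) ℓ
  𝒱₀ (x , _) = x ∈ 𝒜

  𝒱₀-isSubmonoid : IsSubmonoid (units K) 𝒱₀
  𝒱₀-isSubmonoid = record { resp = resp ; ε-closed = 1-closed ; ∙-closed = *-closed }
    where open IsSubring 𝒜-isSubring

-- A′ ⊇ A dominating A.
record Extension (𝔸 𝔸′ : HenselianValuationRing ℓ) : Set ℓ where
  private
    module 𝔸  = HenselianValuationRing 𝔸
    module 𝔸′ = HenselianValuationRing 𝔸′
    module K′ = CommutativeRing 𝔸′.K
  field
    K⟶K′     : 𝔸.K ⟶ 𝔸′.K
    restricts : ∀ {x} → x ∈ 𝔸.𝒜 → K⟶K′ ⟨$⟩ x ∈ 𝔸′.𝒜

  private module h = _⟶_ K⟶K′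

  A⟶A′ : 𝔸.A ⟶ 𝔸′.A
  A⟶A′ = mkHom (λ (x , x∈𝒜) → K⟶K′ ⟨$⟩ x , restricts x∈𝒜)
    h.⟦⟧-cong (λ _ _ → h.+-homo _ _) (λ _ _ → h.*-homo _ _) h.1#-homo

  field
    A⟶A′-local : IsLocalHom A⟶A′

  -- A and A′ have the same image in K′.
  IsEquality : Set ℓ
  IsEquality = (∀ y → ∃[ x ] K⟶K′ ⟨$⟩ x K′.≈ y) × (∀ {x} → K⟶K′ ⟨$⟩ x ∈ 𝔸′.𝒜 → x ∈ 𝔸.𝒜)

  valueGroupHom : 𝔸.valueGroup ⟶ᴳ 𝔸′.valueGroup
  valueGroupHom = mkHomᴳ (unitsHom K⟶K′ ⟨$⟩ᴳ_)
    (λ (u , p) → unitsHom A⟶A′ ⟨$⟩ᴳ u , K′.trans (h.⟦⟧-cong p) (h.*-homo _ _))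
    (λ x y → _⟶ᴳ_.⟦⟧-cong (toCokernel (unitsHom 𝔸′.A⟶K))
       {unitsHom K⟶K′ ⟨$⟩ᴳ (x ∙ y)} {unitsHom K⟶K′ ⟨$⟩ᴳ x ∙′ unitsHom K⟶K′ ⟨$⟩ᴳ y}
       (h.*-homo (proj₁ x) (proj₁ y)))
    where
    open AbelianGroup (units 𝔸.K) using (_∙_)
    open AbelianGroup (units 𝔸′.K) using () renaming (_∙_ to infixl 7 _∙′_)

  residueFieldHom : residueField 𝔸.A-isLocal ⟶ residueField 𝔸′.A-isLocal
  residueFieldHom = residueHom {h = A⟶A′} A⟶A′-local 𝔸.A-isLocal 𝔸′.A-isLocal

infixr 9 _⊚_
_≈ᴱ_ : {𝔸 𝔸′ : HenselianValuationRing ℓ} → Rel (Extension 𝔸 𝔸′) ℓ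
_≈ᴱ_ {𝔸′ = 𝔸′} E F = ∀ x → Extension.K⟶K′ E ⟨$⟩ x ≈ Extension.K⟶K′ F ⟨$⟩ x
  where open CommutativeRing (HenselianValuationRing.K 𝔸′)

_⊚_ : {𝔸 𝔸′ 𝔸″ : HenselianValuationRing ℓ} →
      Extension 𝔸′ 𝔸″ → Extension 𝔸 𝔸′ → Extension 𝔸 𝔸″
F ⊚ E = record
  { K⟶K′ = F.K⟶K′ ⊙ E.K⟶K′
  ; restricts = λ x∈𝒜 → F.restricts (E.restricts x∈𝒜)
  ; A⟶A′-local = λ x u → E.A⟶A′-local x (F.A⟶A′-local (E.A⟶A′ ⟨$⟩ x) u) }
  where
  module E = Extension E
  module F = Extension F

-- g = h ∘ i
IsFactorization : {O H C : CRing ℓ} → O ⟶ H → O ⟶ C → H ⟶ C → Set ℓ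
IsFactorization {C = C} i g h = ∀ x → h ⟨$⟩ (i ⟨$⟩ x) ≈ g ⟨$⟩ x
  where open CommutativeRing C

record IsHenselization {O H : CRing ℓ} (i : O ⟶ H) : Set (suc ℓ) where
  field
    henselian : IsHenselian H
    local     : IsLocalHom i
    universal : (C : CRing ℓ) → IsHenselian C → (g : O ⟶ C) → IsLocalHom g →
                Σ[ h ∈ H ⟶ C ] IsLocalHom h × IsFactorization i g h ×
                (∀ (h′ : H ⟶ C) → IsLocalHom h′ → IsFactorization i g h′ →
                 ∀ y → CommutativeRing._≈_ C (h′ ⟨$⟩ y) (h ⟨$⟩ y))

record ValuativeExtension (𝔸 : HenselianValuationRing ℓ) : Set (suc ℓ) where
  private module 𝔸 = HenselianValuationRing 𝔸
  field
    Λ              : AbelianGroup ℓ ℓ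
    Kˣ⟶Λ           : units 𝔸.K ⟶ᴳ Λ
    Kˣ⟶Λ-injective : Injective (AbelianGroup._≈_ (units 𝔸.K)) (AbelianGroup._≈_ Λ) (Kˣ⟶Λ ⟨$⟩ᴳ_)
    Λ/Kˣ-free      : FreeOfFiniteRank (cokernel Kˣ⟶Λ)
    𝒱              : Pred (AbelianGroup.Carrier Λ) ℓ
    𝒱-valuative    : IsValuativeMonoid Λ 𝒱
    𝒱-dominates-𝒱₀ : _Dominates_ Λ 𝒱 (λ x → ∃[ v ] v ∈ 𝔸.𝒱₀ × AbelianGroup._≈_ Λ (Kˣ⟶Λ ⟨$⟩ᴳ v) x)

  monoid₀ monoid : CommutativeMonoid ℓ ℓ
  monoid₀ = submonoid {G = units 𝔸.K} 𝔸.𝒱₀-isSubmonoid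
  monoid  = submonoid {G = Λ} (IsValuativeMonoid.isSubmonoid 𝒱-valuative)

  ℤ[𝒱₀]⟶A : ℤ[ monoid₀ ] ⟶ 𝔸.A
  ℤ[𝒱₀]⟶A = extendToRing monoid₀ (λ ((x , _) , x∈𝒜) → x , x∈𝒜)
    (λ p → p) (λ x y → refl {proj₁ x .proj₁ * proj₁ y .proj₁}) (refl {1#})
    where open CommutativeRing 𝔸.K

  ℤ[𝒱₀]⟶ℤ[𝒱] : ℤ[ monoid₀ ] ⟶ ℤ[ monoid ]
  ℤ[𝒱₀]⟶ℤ[𝒱] = extendToRing monoid₀
    (λ (v , v∈𝒱₀) → gen (Kˣ⟶Λ ⟨$⟩ᴳ v , proj₁ 𝒱-dominates-𝒱₀ (v , v∈𝒱₀ , AbelianGroup.refl Λ)))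
    (λ p → rel (gen-cong (h.⟦⟧-cong p)))
    (λ _ _ → ≋-trans (rel (gen-cong (h.homo _ _))) (rel (gen-∙ _ _)))
    (≋-trans (rel (gen-cong h.ε-homo)) (rel gen-ε))
    where module h = _⟶ᴳ_ Kˣ⟶Λ

  R : CRing ℓ
  R = tensor 𝔸.A ℤ[ monoid ] (ℤ[𝒱₀]⟶A ⟨$⟩_) (ℤ[𝒱₀]⟶ℤ[𝒱] ⟨$⟩_)

  A⟶R : 𝔸.A ⟶ R
  A⟶R = tensor-left 𝔸.A ℤ[ monoid ] (ℤ[𝒱₀]⟶A ⟨$⟩_) (ℤ[𝒱₀]⟶ℤ[𝒱] ⟨$⟩_)

  ℤ[𝒱]⟶R : ℤ[ monoid ] ⟶ R
  ℤ[𝒱]⟶R = tensor-right 𝔸.A ℤ[ monoid ] (ℤ[𝒱₀]⟶A ⟨$⟩_) (ℤ[𝒱₀]⟶ℤ[𝒱] ⟨$⟩_)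

  𝔭 : Ideal R
  𝔭 = generated R λ r → Σ[ v ∈ ∃ 𝒱 ] proj₁ v ∉ _ˣ Λ 𝒱 × r ≡ ℤ[𝒱]⟶R ⟨$⟩ gen v

module _ {𝔸 𝔸′ : HenselianValuationRing ℓ} (E : Extension 𝔸 𝔸′) where
  private
    module 𝔸  = HenselianValuationRing 𝔸
    module 𝔸′ = HenselianValuationRing 𝔸′
  open Extension E

  record IsLogSmoothOfRationalType : Set (suc ℓ) where
    field
      valuativeExtension : ValuativeExtension 𝔸
    open ValuativeExtension valuativeExtension
    field
      𝔭-prime       : IsPrime R 𝔭
      R𝔭⟶A′         : localizationAt 𝔭-prime ⟶ 𝔸′.A
      henselization : IsHenselization R𝔭⟶A′
      over-A        : ∀ a → CommutativeRing._≈_ 𝔸′.A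
                        (R𝔭⟶A′ ⟨$⟩ (localizeAt 𝔭-prime ⟨$⟩ (A⟶R ⟨$⟩ a)))
                        (A⟶A′ ⟨$⟩ a)

  record IsTameFinite : Set ℓ where
    field
      e f                : ℕ
      ramificationIndex  : HasOrder (cokernel valueGroupHom) e
      residueDegree      : HasDegree residueFieldHom f
      degree             : HasDegree K⟶K′ (e ℕ.* f)
      e-invertible       : IsUnit 𝔸.A (Arithmetic._×_ 𝔸.A e (CommutativeRing.1# 𝔸.A))
      residue-separable  : ∀ x → IsSeparableElement residueFieldHom x

-- A chain A = A₀ ⊆ … ⊆ Aₙ = A′ with n ≥ 0; E is the composite inclusion.
data IsLogSmooth {ℓ} : {𝔸 𝔸′ : HenselianValuationRing ℓ} → Extension 𝔸 𝔸′ → Set (suc ℓ) where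
  done : ∀ {𝔸 𝔸′ : HenselianValuationRing ℓ} {E : Extension 𝔸 𝔸′} →
         Extension.IsEquality E → IsLogSmooth E
  step : ∀ {𝔸 𝔸₁ 𝔸′ : HenselianValuationRing ℓ} {E : Extension 𝔸 𝔸′}
         (E₁ : Extension 𝔸 𝔸₁) (E₂ : Extension 𝔸₁ 𝔸′) → E ≈ᴱ (E₂ ⊚ E₁) →
         IsLogSmoothOfRationalType E₁ ⊎ IsTameFinite E₁ → IsLogSmooth E₂ → IsLogSmooth E

record SeparableClosure (K : CRing ℓ) : Set (suc ℓ) where
  field
    K̄         : CRing ℓ
    K̄-isField : IsField K̄
    K⟶K̄      : K ⟶ K̄
    separable : ∀ x → IsSeparableElement K⟶K̄ x
    closed    : ∀ f → IsSeparablePolynomial K̄ f → ¬ IsConstant K̄ f →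
                ∃[ x ] IsRoot (idHom {R = K̄}) f x

module _ {R : CRing ℓ} (P : Pred (Elt R) ℓ) where
  open CommutativeRing R

  UnitIn : Pred (Elt R) ℓ
  UnitIn x = ∃[ y ] y ∈ P × y * x ≈ 1#

module _ (𝔸 : HenselianValuationRing ℓ) (sep : SeparableClosure (HenselianValuationRing.K 𝔸)) where
  open HenselianValuationRing 𝔸
  open SeparableClosure sep
  private
    module K  = CommutativeRing K
    module K̄ = CommutativeRing K̄

  A⟶K̄ : A ⟶ K̄
  A⟶K̄ = K⟶K̄ ⊙ A⟶K

  -- Kept as a subset of K̄: nothing below uses that it is a subring.
  Ā : Pred (Elt K̄) ℓ
  Ā = IsIntegral A⟶K̄

  record NonzeroProperIdeal : Set (suc ℓ) where
    field
      member   : Pred (Elt K̄) ℓ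
      ⊆Ā       : member ⊆ Ā
      resp     : ∀ {x y} → x K̄.≈ y → x ∈ member → y ∈ member
      0-closed : K̄.0# ∈ member
      +-closed : ∀ {x y} → x ∈ member → y ∈ member → x K̄.+ y ∈ member
      *-closed : ∀ {x y} → x ∈ Ā → y ∈ member → x K̄.* y ∈ member
      nonzero  : ∃[ x ] x ∈ member × ¬ x K̄.≈ K̄.0#
      proper   : K̄.1# ∉ member

  record IntermediateField : Set (suc ℓ) where
    field
      ℒ           : Pred (Elt K̄) ℓ
      ℒ-isSubring : IsSubring K̄ ℒ
      ⁻¹-closed   : ∀ {x y} → x ∈ ℒ → x K̄.* y K̄.≈ K̄.1# → y ∈ ℒ
      K⊆ℒ         : ∀ x → K⟶K̄ ⟨$⟩ x ∈ ℒ

    L : CRing ℓ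
    L = subring {R = K̄} ℒ-isSubring

    private module h = _⟶_ K⟶K̄

    K⟶L : K ⟶ L
    K⟶L = mkHom (λ x → K⟶K̄ ⟨$⟩ x , K⊆ℒ x) h.⟦⟧-cong h.+-homo h.*-homo h.1#-homo

    record IsFiniteGalois : Set ℓ where
      field
        finite    : ∃ (HasDegree K⟶L)
        separable : ∀ x → IsSeparableElement K⟶L x
        normal    : ∀ f → Arithmetic.Irreducible (Poly K) f → ∃ (IsRoot K⟶L f) →
                    Splits L (mapCoefficients K⟶L ⟨$⟩ f)

    B : Pred (Elt K̄) ℓ
    B = ℒ ∩ Ā

    record Φ : Set ℓ where
      field
        L⟶K̄     : L ⟶ K̄
        fixes-K : ∀ x → L⟶K̄ ⟨$⟩ (K⟶L ⟨$⟩ x) K̄.≈ K⟶K̄ ⟨$⟩ x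

    infix 4 _≈Φ_
    _≈Φ_ : Rel Φ ℓ
    φ ≈Φ ψ = ∀ x → Φ.L⟶K̄ φ ⟨$⟩ x K̄.≈ Φ.L⟶K̄ ψ ⟨$⟩ x

    record PrePresentation : Set ℓ where
      field
        size        : ℕ
        S           : Fin size → Elt K̄
        S⊆B         : ∀ s → S s ∈ B
        S-injective : Injective _≡_ K̄._≈_ S
        T           : List (Elt (A [ Fin size ]))
        T⊆kernel    : All (λ t → evaluate A⟶K̄ S ⟨$⟩ t K̄.≈ K̄.0#) T

  module Polydisc (n : ℕ) where

    R : CRing ℓ
    R = K̄ [ Fin n ]

    private module R = CommutativeRing R

    K̄⟶R : K̄ ⟶ R
    K̄⟶R = con

    data R⁺ : Pred (Elt R) ℓ where
      resp          : ∀ {f g} → f R.≈ g → f ∈ R⁺ → g ∈ R⁺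
      scalar        : ∀ {a} → a ∈ Ā → K̄⟶R ⟨$⟩ a ∈ R⁺
      indeterminate : ∀ s → var {R = K̄} s ∈ R⁺
      +-closed      : ∀ {f g} → f ∈ R⁺ → g ∈ R⁺ → f R.+ g ∈ R⁺
      *-closed      : ∀ {f g} → f ∈ R⁺ → g ∈ R⁺ → f R.* g ∈ R⁺

    -- The pairs (𝔭 , V), before any condition is imposed on V.
    record Pair : Set (suc ℓ) where
      field
        𝔭     : Ideal R
        prime : IsPrime R 𝔭

      κ : CRing ℓ
      κ = residueFieldAt prime

      R⟶κ : R ⟶ κ
      R⟶κ = toResidueFieldAt prime

      K̄⟶κ : K̄ ⟶ κ
      K̄⟶κ = R⟶κ ⊙ K̄⟶R

      field
        V : Pred (Elt κ) ℓ

    record IsPoint (z : Pair) : Set ℓ where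
      open Pair z
      field
        V-isSubring       : IsSubring κ V
        V-isValuationRing : IsValuationRing (subring {R = κ} V-isSubring)
        R⁺⊆V              : ∀ {f} → f ∈ R⁺ → R⟶κ ⟨$⟩ f ∈ V

      V-ring : CRing ℓ
      V-ring = subring {R = κ} V-isSubring

      Ā⟶V : ∃ Ā → Elt V-ring
      Ā⟶V (a , a∈Ā) = K̄⟶κ ⟨$⟩ a , R⁺⊆V (scalar a∈Ā)

      K̄⊗V : CRing ℓ
      K̄⊗V = tensor K̄ V-ring proj₁ Ā⟶V

      K̄⊗V⟶κ : K̄⊗V ⟶ κ
      K̄⊗V⟶κ = tensor-universal K̄ V-ring proj₁ Ā⟶V K̄⟶κ (inclusion V-isSubring)
        (λ _ → CommutativeRing.refl κ)

      field
        K̄⊗V≅κ : Bijective (CommutativeRing._≈_ K̄⊗V) (CommutativeRing._≈_ κ) (K̄⊗V⟶κ ⟨$⟩_)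
        -- The maximal ideals of Ā and of V consist of the non-units.
        centre : ∀ a → (¬ IsUnit V-ring (Ā⟶V a)) ⇔ (¬ UnitIn {R = K̄} Ā (proj₁ a))

    D : Set (suc ℓ)
    D = Σ Pair IsPoint

    -- ∣ f ∣ z ≤ ∣ g ∣ z, that is Vf ⊆ Vg in the residue field at z.
    infix 4 _≤⟨_⟩_
    _≤⟨_⟩_ : Elt R → D → Elt R → Set ℓ
    f ≤⟨ z , _ ⟩ g = ∀ {v} → v ∈ V → ∃[ w ] w ∈ V × v * (R⟶κ ⟨$⟩ f) ≈ w * (R⟶κ ⟨$⟩ g)
      where
      open Pair z
      open CommutativeRing κ

    NonzeroAt : D → Pred (Elt R) ℓ
    NonzeroAt (z , _) g = ¬ R⟶κ ⟨$⟩ g ≈ 0#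
      where
      open Pair z
      open CommutativeRing κ

    -- The topology generated by the sets { z : ∣ f ∣ z ≤ ∣ g ∣ z ≠ 0 }.
    data IsOpen : Pred D (suc ℓ) → Set (suc (suc ℓ)) where
      basic        : ∀ f g {O} → O ≐ (λ z → f ≤⟨ z ⟩ g × NonzeroAt z g) → IsOpen O
      whole        : ∀ {O} → (∀ z → z ∈ O) → IsOpen O
      intersection : ∀ {O P} → IsOpen O → IsOpen P → IsOpen (O ∩ P)
      union        : ∀ {J : Set (suc ℓ)} {O : J → Pred D (suc ℓ)} {P} →
                     (∀ j → IsOpen (O j)) → P ≐ (λ z → ∃[ j ] z ∈ O j) → IsOpen P

    IsOpenIn : Pred D ℓ → Pred D (suc ℓ) → Set (suc (suc ℓ))
    IsOpenIn X U = ∃[ O ] IsOpen O × U ≐ X ∩ O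

    IsClopenIn : Pred D ℓ → Pred D (suc ℓ) → Set (suc (suc ℓ))
    IsClopenIn X U = IsOpenIn X U × IsOpenIn X (X ∖ U)

    -- 𝔭 = ker (R → K̄ , y_s ↦ y s), and V is the image of Ā under K̄ ≅ κ(𝔭).
    rationalPair : (Fin n → Elt K̄) → Pair
    rationalPair y = record
      { 𝔭 = 𝔭 ; prime = prime
      ; V = λ x → ∃[ a ] a ∈ Ā × CommutativeRing._≈_ (residueFieldAt prime) x
              (toResidueFieldAt prime ⟨$⟩ (K̄⟶R ⟨$⟩ a)) }
      where
      𝔭 : Ideal R
      𝔭 = kernel (evaluate (idHom {R = K̄}) y)

      prime : IsPrime R 𝔭
      prime = kernel-isPrime (evaluate (idHom {R = K̄}) y) (field⇒domain K̄ K̄-isField)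

  module _ (ℒ : IntermediateField) where
    open IntermediateField ℒ

    module _ (𝒫 : PrePresentation) (I : Pred (Elt K̄) ℓ) where
      open PrePresentation 𝒫
      open Polydisc size

      X : Pred D ℓ
      X z = All (λ t → ∃[ a ] a ∈ I × mapCoefficients A⟶K̄ ⟨$⟩ t ≤⟨ z ⟩ K̄⟶R ⟨$⟩ a) T

      conjugate : Φ → Pair
      conjugate φ = rationalPair λ s → Φ.L⟶K̄ φ ⟨$⟩ (S s , proj₁ (S⊆B s))

      record Separates : Set (suc (suc ℓ)) where
        field
          U        : Φ → Pred D (suc ℓ)
          U-cong   : ∀ {φ ψ} → φ ≈Φ ψ → U φ ⊆ U ψ
          clopen   : ∀ φ → IsClopenIn X (U φ)
          contains : ∀ φ → Σ[ p ∈ IsPoint (conjugate φ) ] (conjugate φ , p) ∈ U φ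
          covers   : ∀ {z} → z ∈ X → ∃[ φ ] z ∈ U φ
          disjoint : ∀ {φ ψ z} → z ∈ U φ → z ∈ U ψ → φ ≈Φ ψ

    NonLogBounded : Pred (Elt K̄) ℓ → Set (suc (suc ℓ))
    NonLogBounded I = ∃[ 𝒫 ] Separates 𝒫 I

-- A separable closure of K′ containing one of K.
record ClosureExtension {𝔸 𝔸′ : HenselianValuationRing ℓ} (E : Extension 𝔸 𝔸′)
       (sep  : SeparableClosure (HenselianValuationRing.K 𝔸))
       (sep′ : SeparableClosure (HenselianValuationRing.K 𝔸′)) : Set ℓ where
  open SeparableClosure sep
  open SeparableClosure sep′ using () renaming (K̄ to K̄′; K⟶K̄ to K′⟶K̄′)
  open CommutativeRing K̄′
  field
    K̄⟶K̄′    : K̄ ⟶ K̄′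
    commutes : ∀ x → K̄⟶K̄′ ⟨$⟩ (K⟶K̄ ⟨$⟩ x) ≈ K′⟶K̄′ ⟨$⟩ (Extension.K⟶K′ E ⟨$⟩ x)

module _ {𝔸 𝔸′ : HenselianValuationRing ℓ} {E : Extension 𝔸 𝔸′}
         {sep  : SeparableClosure (HenselianValuationRing.K 𝔸)}
         {sep′ : SeparableClosure (HenselianValuationRing.K 𝔸′)}
         (C : ClosureExtension E sep sep′) where
  open SeparableClosure sep
  open SeparableClosure sep′ using () renaming (K̄ to K̄′; K⟶K̄ to K′⟶K̄′)
  open CommutativeRing K̄′
  open ClosureExtension C

  -- Ā′I
  data ExtendedIdeal (I : Pred (Elt K̄) ℓ) : Pred (Elt K̄′) ℓ where
    resp     : ∀ {x y} → x ≈ y → x ∈ ExtendedIdeal I → y ∈ ExtendedIdeal I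
    0-closed : 0# ∈ ExtendedIdeal I
    +-closed : ∀ {x y} → x ∈ ExtendedIdeal I → y ∈ ExtendedIdeal I → x + y ∈ ExtendedIdeal I
    multiple : ∀ {a x} → a ∈ Ā 𝔸′ sep′ → x ∈ I → a * (K̄⟶K̄′ ⟨$⟩ x) ∈ ExtendedIdeal I

  -- LK′, the smallest subfield of K̄′ containing L and K′.
  data Compositum (ℒ : Pred (Elt K̄) ℓ) : Pred (Elt K̄′) ℓ where
    from-ℒ    : ∀ {x} → x ∈ ℒ → K̄⟶K̄′ ⟨$⟩ x ∈ Compositum ℒ
    from-K′   : ∀ x → K′⟶K̄′ ⟨$⟩ x ∈ Compositum ℒ
    resp      : ∀ {x y} → x ≈ y → x ∈ Compositum ℒ → y ∈ Compositum ℒ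
    +-closed  : ∀ {x y} → x ∈ Compositum ℒ → y ∈ Compositum ℒ → x + y ∈ Compositum ℒ
    *-closed  : ∀ {x y} → x ∈ Compositum ℒ → y ∈ Compositum ℒ → x * y ∈ Compositum ℒ
    -‿closed  : ∀ {x} → x ∈ Compositum ℒ → - x ∈ Compositum ℒ
    ⁻¹-closed : ∀ {x y} → x ∈ Compositum ℒ → x * y ≈ 1# → y ∈ Compositum ℒ

  compositum : IntermediateField 𝔸 sep → IntermediateField 𝔸′ sep′
  compositum ℒ = record
    { ℒ = Compositum (IntermediateField.ℒ ℒ)
    ; ℒ-isSubring = record
      { resp = resp ; +-closed = +-closed ; *-closed = *-closed ; -‿closed = -‿closed
      ; 0-closed = resp h.0#-homo (from-K′ _) ; 1-closed = resp h.1#-homo (from-K′ _) }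
    ; ⁻¹-closed = ⁻¹-closed
    ; K⊆ℒ = from-K′ }
    where module h = _⟶_ K′⟶K̄′

module _ (𝔸 : HenselianValuationRing ℓ) (sep : SeparableClosure (HenselianValuationRing.K 𝔸)) where
  open HenselianValuationRing 𝔸
  open SeparableClosure sep
  private module K̄ = CommutativeRing K̄

  record LogBounded (ℒ : IntermediateField 𝔸 sep) (I : Pred (Elt K̄) ℓ) : Set (suc (suc ℓ)) where
    field
      {𝔸′}             : HenselianValuationRing ℓ
      extension        : Extension 𝔸 𝔸′
      isLogSmooth      : IsLogSmooth extension
      sep′             : SeparableClosure (HenselianValuationRing.K 𝔸′)
      closureExtension : ClosureExtension extension sep sep′
      bounded          : NonLogBounded 𝔸′ sep′ (compositum closureExtension ℒ)
                           (ExtendedIdeal closureExtension I)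

  -- Gal(K̄/K)
  record Galois : Set ℓ where
    field
      σ              : K̄ ⟶ K̄
      isIsomorphism  : RingMorphisms.IsRingIsomorphism K̄.rawRing K̄.rawRing (σ ⟨$⟩_)
      fixes-K        : ∀ x → σ ⟨$⟩ (K⟶K̄ ⟨$⟩ x) K̄.≈ K⟶K̄ ⟨$⟩ x

  -- σ restricts to the identity of L, that is σ ∈ ker (Gal(K̄/K) → Gal(L/K)).
  FixesField : IntermediateField 𝔸 sep → Pred Galois ℓ
  FixesField ℒ σ = ∀ {x} → x ∈ IntermediateField.ℒ ℒ → Galois.σ σ ⟨$⟩ x K̄.≈ x

  Gal-log Gal-nlog : NonzeroProperIdeal 𝔸 sep → Pred Galois (suc (suc ℓ))
  Gal-log I σ = ∀ ℒ → IntermediateField.IsFiniteGalois ℒ →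
    LogBounded ℒ (NonzeroProperIdeal.member I) → FixesField ℒ σ
  Gal-nlog I σ = ∀ ℒ → IntermediateField.IsFiniteGalois ℒ →
    NonLogBounded 𝔸 sep ℒ (NonzeroProperIdeal.member I) → FixesField ℒ σ

{-# OPTIONS --safe #-}

-- Shrinking the ideal shrinks X(S, T, I), so a separation for I restricts to one
-- for J ⊆ I; the conjugates φ survive because each t ∈ T vanishes at φ, whence
-- |t|(φ) ≤ |0|(φ) with 0 ∈ J.  For Gal_log ⊆ Gal_nlog, A itself is a log smooth
-- extension of A: then LK′ = L and Ā′I = I, up to extensional equality.
module Submission where

open import Defs
open import Algebra.Bundles using (CommutativeRing)
open import Data.Fin.Base using (Fin)
import Data.List.Relation.Unary.All as All
open import Data.Product.Base using (_×_; _,_; proj₁; proj₂; map₂)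
open import Data.Sum.Base using (inj₁; inj₂)
open import Function.Base using (id; _∘_)
open import Level using (Level)
open import Relation.Nullary.Negation.Core using (¬_)
open import Relation.Unary using (Pred; _∈_; _⊆_; _∩_)

private variable
  ℓ : Level

module _ {R S : CRing ℓ} {X : Set} (g h : R [ X ] ⟶ S) where
  open CommutativeRing S
  private
    module g = _⟶_ g
    module h = _⟶_ h

  -- Elements of `R [ X ]` are syntactic terms, so structural induction suffices; the ring relations
  -- never enter.
  polynomial-hom-ext : (∀ a → g ⟨$⟩ (con {R = R} ⟨$⟩ a) ≈ h ⟨$⟩ (con {R = R} ⟨$⟩ a)) →
                       (∀ x → g ⟨$⟩ var {R = R} x ≈ h ⟨$⟩ var {R = R} x) →
                       ∀ t → g ⟨$⟩ t ≈ h ⟨$⟩ t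
  polynomial-hom-ext on-con on-var = go
    where
    go : ∀ t → g ⟨$⟩ t ≈ h ⟨$⟩ t
    go (gen (inj₁ a)) = on-con a
    go (gen (inj₂ x)) = on-var x
    go (s ⊕ t) = trans (g.+-homo s t) (trans (+-cong (go s) (go t)) (sym (h.+-homo s t)))
    go (s ⊗ t) = trans (g.*-homo s t) (trans (*-cong (go s) (go t)) (sym (h.*-homo s t)))
    go (⊖ t)   = trans (g.-‿homo t) (trans (-‿cong (go t)) (sym (h.-‿homo t)))
    go 𝟘       = trans g.0#-homo (sym h.0#-homo)
    go 𝟙       = trans g.1#-homo (sym h.1#-homo)

toResidueFieldAt-vanishes : {R : CRing ℓ} {𝔭 : Ideal R} (prime : IsPrime R 𝔭) → ∀ {x} → x ∈ member 𝔭 →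
  CommutativeRing._≈_ (residueFieldAt prime) (toResidueFieldAt prime ⟨$⟩ x)
    (CommutativeRing.0# (residueFieldAt prime))
toResidueFieldAt-vanishes {R = R} {𝔭} prime x∈𝔭 =
  -- Being zero in the quotient by `𝔭` unfolds to `x + - 0# ∈ 𝔭`, hence the detour through `-0#≈0#`.
  κ.trans (_⟶_.⟦⟧-cong loc (Ideal.resp 𝔭 (sym (trans (+-congˡ -0#≈0#) (+-identityʳ _))) x∈𝔭))
    (_⟶_.0#-homo loc)
  where
  open CommutativeRing R
  open import Algebra.Properties.Ring ring using (-0#≈0#)
  module κ = CommutativeRing (residueFieldAt prime)
  loc = localize (nonzero-multiplicative (quotient-isDomain 𝔭 prime))

module _ (𝔸 : HenselianValuationRing ℓ) (sep : SeparableClosure (HenselianValuationRing.K 𝔸)) where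
  open HenselianValuationRing 𝔸
  open SeparableClosure sep
  private module K̄ = CommutativeRing K̄

  module _ (ℒ : IntermediateField 𝔸 sep) (𝒫 : IntermediateField.PrePresentation ℒ) where
    open IntermediateField ℒ hiding (ℒ)
    open PrePresentation 𝒫
    open Polydisc 𝔸 sep size

    X-mono : {I J : Pred (Elt K̄) ℓ} → J ⊆ I → X 𝔸 sep ℒ 𝒫 J ⊆ X 𝔸 sep ℒ 𝒫 I
    X-mono J⊆I = All.map λ (a , a∈J , t≤a) → a , J⊆I a∈J , t≤a

    -- The coefficients of `t` come from `A`, whose image `φ` fixes, so evaluating `t` at the
    -- conjugates amounts to applying `φ` to its value at `S` in `L`.
    kernel-at-conjugates : (φ : Φ) (t : Elt (A [ Fin size ])) →
      evaluate (A⟶K̄ 𝔸 sep) S ⟨$⟩ t K̄.≈ K̄.0# →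
      mapCoefficients (A⟶K̄ 𝔸 sep) ⟨$⟩ t ∈
        member (kernel (evaluate (idHom {R = K̄}) λ s → Φ.L⟶K̄ φ ⟨$⟩ (S s , proj₁ (S⊆B s))))
    kernel-at-conjugates φ t t↦0 =
      K̄.trans (polynomial-hom-ext (evaluate (idHom {R = K̄}) (λ s → φ.L⟶K̄ ⟨$⟩ S′ s)
                                       ⊙ mapCoefficients (A⟶K̄ 𝔸 sep))
                 (φ.L⟶K̄ ⊙ evaluate A⟶L S′) (λ a → K̄.sym (φ.fixes-K (A⟶K ⟨$⟩ a))) (λ _ → K̄.refl) t)
      -- Equality in `L` is equality in `K̄`, so the vanishing of `t` at `S` may be checked there
      -- before applying `φ`.
      (K̄.trans (_⟶_.⟦⟧-cong φ.L⟶K̄ (K̄.trans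
                 (polynomial-hom-ext (inclusion ℒ-isSubring ⊙ evaluate A⟶L S′) (evaluate (A⟶K̄ 𝔸 sep) S)
                   (λ _ → K̄.refl) (λ _ → K̄.refl) t)
                 t↦0))
        (_⟶_.0#-homo φ.L⟶K̄))
      where
      module φ = Φ φ
      S′ : Fin size → Elt L
      S′ s = S s , proj₁ (S⊆B s)
      A⟶L : A ⟶ L
      A⟶L = K⟶L ⊙ A⟶K

    conjugate∈X : {I : Pred (Elt K̄) ℓ} → K̄.0# ∈ I → ∀ φ (p : IsPoint (conjugate 𝔸 sep ℒ 𝒫 I φ)) →
                  (conjugate 𝔸 sep ℒ 𝒫 I φ , p) ∈ X 𝔸 sep ℒ 𝒫 I
    conjugate∈X {I} 0∈I φ p = All.map
      -- Take `a = 0` and `w = v`: both `t` and `a` map to zero in `κ`.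
      (λ {t} t↦0 → K̄.0# , 0∈I , λ {v} v∈V → v , v∈V ,
        *-congˡ {v} (trans (toResidueFieldAt-vanishes prime (kernel-at-conjugates φ t t↦0))
                  (sym (_⟶_.0#-homo K̄⟶κ))))
      T⊆kernel
      where
      open Pair (conjugate 𝔸 sep ℒ 𝒫 I φ)
      open CommutativeRing κ

    module _ {X Y : Pred D ℓ} (Y⊆X : Y ⊆ X) where

      IsOpenIn-restrict : ∀ {U} → IsOpenIn X U → IsOpenIn Y (U ∩ Y)
      IsOpenIn-restrict (O , O-open , U⊆X∩O , X∩O⊆U) = O , O-open
        , (λ (z∈U , z∈Y) → z∈Y , proj₂ (U⊆X∩O z∈U))
        , (λ (z∈Y , z∈O) → X∩O⊆U (Y⊆X z∈Y , z∈O) , z∈Y)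

      -- The open sets that cut out `U` and its complement in `X` cut out `U ∩ Y` and its complement
      -- in `Y`.
      IsClopenIn-restrict : ∀ {U} → IsClopenIn X U → IsClopenIn Y (U ∩ Y)
      IsClopenIn-restrict (U-open , O , O-open , X∖U⊆X∩O , X∩O⊆X∖U) =
        IsOpenIn-restrict U-open , O , O-open
        , (λ (z∈Y , z∉U∩Y) → z∈Y , proj₂ (X∖U⊆X∩O (Y⊆X z∈Y , λ z∈U → z∉U∩Y (z∈U , z∈Y))))
        , (λ (z∈Y , z∈O) → z∈Y , λ (z∈U , _) → proj₂ (X∩O⊆X∖U (Y⊆X z∈Y , z∈O)) z∈U)

    Separates-antitone : {I J : Pred (Elt K̄) ℓ} → J ⊆ I → K̄.0# ∈ J →
                         Separates 𝔸 sep ℒ 𝒫 I → Separates 𝔸 sep ℒ 𝒫 J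
    Separates-antitone {I} {J} J⊆I 0∈J separates = record
      { U        = λ φ → U φ ∩ X 𝔸 sep ℒ 𝒫 J
      ; U-cong   = λ φ≈ψ (z∈U , z∈X) → U-cong φ≈ψ z∈U , z∈X
      ; clopen   = λ φ → IsClopenIn-restrict (λ {z} → X-mono {I} {J} J⊆I {z}) (clopen φ)
      -- The proof that the conjugate is a point carries over, since `conjugate` has the same value
      -- for `I` and `J`.
      ; contains = λ φ → map₂ (λ {p} φ∈U → φ∈U , conjugate∈X 0∈J φ p) (contains φ)
      ; covers   = λ {z} z∈X → map₂ (_, z∈X) (covers (X-mono {I} {J} J⊆I {z} z∈X))
      ; disjoint = λ (z∈Uφ , _) (z∈Uψ , _) → disjoint z∈Uφ z∈Uψ }
      where open Separates separates

  NonLogBounded-antitone : ∀ ℒ {I J : Pred (Elt K̄) ℓ} → J ⊆ I → K̄.0# ∈ J →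
                           NonLogBounded 𝔸 sep ℒ I → NonLogBounded 𝔸 sep ℒ J
  NonLogBounded-antitone ℒ J⊆I 0∈J (𝒫 , separates) = 𝒫 , Separates-antitone ℒ 𝒫 J⊆I 0∈J separates

  module _ {ℒ ℳ : IntermediateField 𝔸 sep} where
    private
      module ℒ = IntermediateField ℒ
      module ℳ = IntermediateField ℳ

    Φ-restrict : ℒ.ℒ ⊆ ℳ.ℒ → ℳ.Φ → ℒ.Φ
    Φ-restrict ℒ⊆ℳ φ = record
      { L⟶K̄ = φ.L⟶K̄ ⊙ mkHom (map₂ ℒ⊆ℳ) id (λ _ _ → K̄.refl) (λ _ _ → K̄.refl) K̄.refl
      -- The two copies of `x` in `ℳ` differ only in their membership proofs, which the equality of
      -- a subring ignores.
      ; fixes-K = λ x → K̄.trans (_⟶_.⟦⟧-cong φ.L⟶K̄ K̄.refl) (φ.fixes-K x) }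
      where module φ = ℳ.Φ φ

  -- Transports boundedness between extensionally equal subfields. The polydisc and `X` depend only
  -- on `size`, `T` and the ideal, so the same sets serve, reindexed along restriction of `φ`.
  NonLogBounded-resp : ∀ {ℒ ℳ} → IntermediateField.ℒ ℒ ⊆ IntermediateField.ℒ ℳ →
                       IntermediateField.ℒ ℳ ⊆ IntermediateField.ℒ ℒ →
                       {I : Pred (Elt K̄) ℓ} → NonLogBounded 𝔸 sep ℒ I → NonLogBounded 𝔸 sep ℳ I
  NonLogBounded-resp {ℒ} {ℳ} ℒ⊆ℳ ℳ⊆ℒ (𝒫 , separates) =
    record
      { size = size ; S = S ; S⊆B = λ s → ℒ⊆ℳ (proj₁ (S⊆B s)) , proj₂ (S⊆B s)
      ; S-injective = S-injective ; T = T ; T⊆kernel = T⊆kernel }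
    , record
      { U        = λ φ → U (restrict φ)
      ; U-cong   = λ φ≈ψ → U-cong (φ≈ψ ∘ map₂ ℒ⊆ℳ)
      ; clopen   = λ φ → clopen (restrict φ)
      ; contains = λ φ → contains (restrict φ)
      ; covers   = λ z∈X → let φ , z∈U = covers z∈X in
                   -- Extending and then restricting returns `φ` up to membership proofs, hence only
                   -- up to `≈Φ`; `U-cong` absorbs this.
                   extend φ , U-cong (λ _ → _⟶_.⟦⟧-cong (ℒ.Φ.L⟶K̄ φ) K̄.refl) z∈U
      ; disjoint = λ {φ} {ψ} z∈Uφ z∈Uψ x →
                   K̄.trans (_⟶_.⟦⟧-cong (ℳ.Φ.L⟶K̄ φ) K̄.refl)
                  (K̄.trans (disjoint z∈Uφ z∈Uψ (map₂ ℳ⊆ℒ x))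
                            (_⟶_.⟦⟧-cong (ℳ.Φ.L⟶K̄ ψ) K̄.refl)) }
    where
    module ℒ = IntermediateField ℒ
    module ℳ = IntermediateField ℳ
    open ℒ.PrePresentation 𝒫
    open Separates separates
    restrict : ℳ.Φ → ℒ.Φ
    restrict = Φ-restrict ℒ⊆ℳ
    extend : ℒ.Φ → ℳ.Φ
    extend = Φ-restrict ℳ⊆ℒ

  idExtension : Extension 𝔸 𝔸
  idExtension = record { K⟶K′ = idHom ; restricts = id ; A⟶A′-local = λ _ u → u }

  idExtension-isLogSmooth : IsLogSmooth idExtension
  idExtension-isLogSmooth = done ((λ y → y , CommutativeRing.refl K) , id)

  idClosureExtension : ClosureExtension idExtension sep sep
  idClosureExtension = record { K̄⟶K̄′ = idHom ; commutes = λ _ → K̄.refl }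

  -- Minimality of the compositum: `ℒ` is already a subfield containing `K`. The reverse inclusion
  -- is the constructor `from-ℒ`.
  Compositum⊆ℒ : (ℒ : IntermediateField 𝔸 sep) →
    Compositum idClosureExtension (IntermediateField.ℒ ℒ) ⊆ IntermediateField.ℒ ℒ
  Compositum⊆ℒ ℒ = go
    where
    open IntermediateField ℒ using (ℒ-isSubring; K⊆ℒ) renaming (⁻¹-closed to ℒ-⁻¹-closed)
    module ℒ = IsSubring ℒ-isSubring
    go : Compositum idClosureExtension (IntermediateField.ℒ ℒ) ⊆ IntermediateField.ℒ ℒ
    go (from-ℒ p)       = p
    go (from-K′ x)      = K⊆ℒ x
    go (resp x≈y p)     = ℒ.resp x≈y (go p)
    go (+-closed p q)   = ℒ.+-closed (go p) (go q)
    go (*-closed p q)   = ℒ.*-closed (go p) (go q)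
    go (-‿closed p)     = ℒ.-‿closed (go p)
    go (⁻¹-closed p xy) = ℒ-⁻¹-closed (go p) xy

  module _ (I : NonzeroProperIdeal 𝔸 sep) where
    private module I = NonzeroProperIdeal I

    ExtendedIdeal⊆I : ExtendedIdeal idClosureExtension I.member ⊆ I.member
    ExtendedIdeal⊆I (resp x≈y p)     = I.resp x≈y (ExtendedIdeal⊆I p)
    ExtendedIdeal⊆I 0-closed         = I.0-closed
    ExtendedIdeal⊆I (+-closed p q)   = I.+-closed (ExtendedIdeal⊆I p) (ExtendedIdeal⊆I q)
    ExtendedIdeal⊆I (multiple a∈Ā p) = I.*-closed a∈Ā p

    NonLogBounded⇒LogBounded : ∀ {ℒ} → NonLogBounded 𝔸 sep ℒ I.member → LogBounded 𝔸 sep ℒ I.member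
    NonLogBounded⇒LogBounded {ℒ} bounded = record
      { extension        = idExtension
      ; isLogSmooth      = idExtension-isLogSmooth
      ; sep′             = sep
      ; closureExtension = idClosureExtension
      -- First replace `ℒ` by its compositum with `K`, then shrink `I` to its extension.
      ; bounded          = NonLogBounded-antitone _ ExtendedIdeal⊆I 0-closed
                             (NonLogBounded-resp {ℒ} from-ℒ (Compositum⊆ℒ ℒ) bounded) }

module _ (𝔸 : HenselianValuationRing ℓ) (sep : SeparableClosure (HenselianValuationRing.K 𝔸)) where

  -- Keep the same log smooth extension and closure: extending ideals is monotone, so the
  -- non-logarithmic case applies over `𝔸′`. Zero lies in `ExtendedIdeal` by a constructor.
  LogBounded-antitone : ∀ {ℒ} {I J : Pred (Elt (SeparableClosure.K̄ sep)) ℓ} → J ⊆ I →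
                        LogBounded 𝔸 sep ℒ I → LogBounded 𝔸 sep ℒ J
  LogBounded-antitone {I = I} {J} J⊆I logBounded = record
    { extension = extension ; isLogSmooth = isLogSmooth
    ; sep′ = sep′ ; closureExtension = closureExtension
    ; bounded = NonLogBounded-antitone 𝔸′ sep′ _ ExtendedIdeal-mono 0-closed bounded }
    where
    open LogBounded logBounded
    ExtendedIdeal-mono : ExtendedIdeal closureExtension J ⊆ ExtendedIdeal closureExtension I
    ExtendedIdeal-mono (resp x≈y p)     = resp x≈y (ExtendedIdeal-mono p)
    ExtendedIdeal-mono 0-closed         = 0-closed
    ExtendedIdeal-mono (+-closed p q)   = +-closed (ExtendedIdeal-mono p) (ExtendedIdeal-mono q)
    ExtendedIdeal-mono (multiple a∈Ā p) = multiple a∈Ā (J⊆I p)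

proposition4p3p1 : ∀ {ℓ} (𝔸 : HenselianValuationRing ℓ) → ¬ IsField (HenselianValuationRing.A 𝔸) →
    (sep : SeparableClosure (HenselianValuationRing.K 𝔸)) →
    (I J : NonzeroProperIdeal 𝔸 sep) →
    Gal-log 𝔸 sep I ⊆ Gal-nlog 𝔸 sep I ×
    (NonzeroProperIdeal.member J ⊆ NonzeroProperIdeal.member I →
    Gal-log 𝔸 sep J ⊆ Gal-log 𝔸 sep I ×
    Gal-nlog 𝔸 sep J ⊆ Gal-nlog 𝔸 sep I)
proposition4p3p1 𝔸 _ sep I J =
    -- Inclusions reverse: if one bound implies another, the second admits more fields `ℒ`, and its
    -- group is an intersection of more kernels.
    (λ σ∈log ℒ galois bounded → σ∈log ℒ galois (NonLogBounded⇒LogBounded 𝔸 sep I bounded))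
  , λ J⊆I →
      (λ σ∈log ℒ galois bounded → σ∈log ℒ galois (LogBounded-antitone 𝔸 sep J⊆I bounded))
    , (λ σ∈nlog ℒ galois bounded → σ∈nlog ℒ galois
        (NonLogBounded-antitone 𝔸 sep ℒ J⊆I (NonzeroProperIdeal.0-closed J) bounded))
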